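{- Let $(W,S)$ be a Coxeter system, let $I,J\subset S$ be finitary, and let $r$ be a core $(I,J)$-coset. Then one of the following two cases holds. (a) $r$ is an identity coset, meaning $I=J$ and $\underline r=\mathrm{id}$. Then $[I]$ is the unique reduced expression for $r$. (b) $r=p.q$ (a reduced composition) for core cosets $p$ and $q$, where for some $s\in S\setminus I$ (with $I\cup\{s\}$ finitary) and $t=w_{I\cup\{s\}}\,s\,w_{I\cup\{s\}}$, $p$ is the coset with reduced expression $[I+s-t]:=[I,\ I\cup\{s\},\ (I\cup\{s\})\setminus\{t\}]$. Moreover, $[I+s-t]$ is the unique reduced expression for $p$. (The possibility that $r=p$ and $q$ is an identity coset is allowed.)
   Context: Let $(W,S)$ be a Coxeter system with length function $\ell$. A subset $I\subset S$ is finitary if $W_I$ is finite; then $w_I$ is its longest element and $\ell(I)=\ell(w_I)$. For finitary $I,J$, an $(I,J)$-coset is an element $p\in W_I\backslash W/W_J$ (with $(I,J)$ part of the data), with unique Bruhat-maximal element $\overline p$ and unique Bruhat-minimal element $\underline p$. It is a core coset if $I=\underline pJ\underline p^{ -1}$. Composition: let $*$ be the $0$-Hecke (star) product on $W$ (so $s*w=sw$ if $\ell(sw)>\ell(w)$, and $s*w=w$ otherwise). For an $(I,J)$-coset $p$ and a $(J,K)$-coset $q$, $p*q=W_I(\overline p*\overline q)W_K$ as an $(I,K)$-coset, and $\overline{p*q}=\overline p*\overline q$. The composition is reduced, written $p.q$, if $\overline p*\overline q=(\overline pw_J^{ -1})\overline q$ with $\ell(\overline p*\overline q)=\ell(\overline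 p)-\ell(J)+\ell(\overline q)$. Expressions: a (singlestep) $(I,J)$-expression is a sequence $[I=L_0,L_1,\dots,L_d=J]$ of finitary subsets, in which each $L_{i}$ is obtained from $L_{i-1}$ by adding or removing exactly one element of $S$. Grouping consecutive additions and consecutive removals gives a sequence $[[I=I_0\subset K_1\supset I_1\subset\cdots\subset K_m\supset I_m=J]]$ (equalities allowed at the ends; for $d=0$ take $[[I\subset I\supset I]]$). The expression is a reduced expression for $p$ if $\overline p=w_{K_1}w_{I_1}^{ -1}w_{K_2}\cdots w_{I_{m-1}}^{ -1}w_{K_m}$ and $\ell(\overline p)=\ell(K_1)-\ell(I_1)+\ell(K_2)-\cdots-\ell(I_{m-1})+\ell(K_m)$. Uniqueness of reduced expressions is among singlestep expressions. -}

module Defs where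

open import Algebra.Bundles using (Group)
import Algebra.Definitions.RawMonoid
open import Axiom.ExcludedMiddle using (ExcludedMiddle)
open import Data.Integer.Base as ℤ using (ℤ; +_)
open import Data.List.Base
  using (List; []; _∷_; _++_; concat; replicate; foldr; length; map; cartesianProductWith)
import Data.List.Membership.Setoid
import Data.List.Membership.Setoid.Properties as Membershipₚ
open import Data.List.Relation.Binary.Pointwise using (Pointwise)
open import Data.List.Relation.Unary.All using (All; [])
import Data.List.Relation.Unary.All as All
open import Data.List.Relation.Unary.Any using (here; there)
open import Data.Nat.Base using (ℕ; _≤_; _<_; _∸_; _⊔_)
open import Data.Nat.Divisibility using (_∣_)
open import Data.Nat.Induction using (<-rec)
import Data.Nat.Properties as ℕₚ
open import Data.Product.Base using (_×_; _,_; proj₁; proj₂; ∃; ∃-syntax)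
open import Function.Bundles using (_⇔_)
open import Level using (Level) renaming (suc to lsuc)
open import Relation.Binary.Core using (Rel)
open import Relation.Binary.Construct.Closure.Equivalence using (EqClosure)
open import Relation.Binary.Construct.Closure.Transitive using (TransClosure; [_]; _∷_)
open import Relation.Binary.PropositionalEquality.Core using (_≡_; refl; subst₂)
open import Relation.Nullary.Decidable.Core using (yes; no)
open import Relation.Nullary.Negation.Core using (¬_)
open import Relation.Unary using (Pred; _∈_; _∉_; _≐_; _∪_; _∖_; ｛_｝)

-- n is the order of g, where n = 0 encodes infinite order
-- (0 ∣ k holds only for k = 0).
HasOrder : ∀ {c ℓ} (G : Group c ℓ) → Group.Carrier G → ℕ → Set ℓ
HasOrder G g n = ∀ k → (k · g ≈ ε) ⇔ (n ∣ k)
  where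
  open Group G
  open Algebra.Definitions.RawMonoid rawMonoid using () renaming (_×_ to _·_)

-- Deletion of a Coxeter relator (s t)^m(s,t) from a word; if m(s,t) = 0,
-- i.e. s t has infinite order, the relator is the empty word.
data Deletes {a} {S : Set a} (m : S → S → ℕ) : Rel (List S) a where
  delete : ∀ u s t v →
    Deletes m (u ++ concat (replicate (m s t) (s ∷ t ∷ [])) ++ v) (u ++ v)

-- W is generated by a set S of elements of order 2, subject only to the
-- relations (s t)^m(s,t) = 1 with m(s,t) the order of s t in W.  The relators
-- with s = t are the words s s, so the monoid presented in this way is already
-- a group, and words need no formal inverses.
record CoxeterSystem (a : Level) : Set (lsuc a) where
  field
    W : Group a a
  open Group W public
  field
    S             : Set a
    gen           : S → Carrier
    gen-injective : ∀ {s t} → gen s ≈ gen t → s ≡ t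
    gen-order     : ∀ s → HasOrder W (gen s) 2
    m             : S → S → ℕ
    m-order       : ∀ s t → HasOrder W (gen s ∙ gen t) (m s t)

  eval : List S → Carrier
  eval = foldr (λ s w → gen s ∙ w) ε

  field
    generates : ∀ w → ∃[ u ] eval u ≈ w
    presented : ∀ {u v} → eval u ≈ eval v → EqClosure (Deletes m) u v

-- Excluded middle supplies the classical logic in which lengths, longest
-- elements and extremal coset elements exist.
module Cosets {a : Level} (em : ExcludedMiddle a) (𝒲 : CoxeterSystem a) where

  open CoxeterSystem 𝒲 public
    renaming (refl to ≈-refl; sym to ≈-sym; trans to ≈-trans)
  open Data.List.Membership.Setoid setoid using () renaming (_∈_ to _∈ₗ_)

  private
    least : (P : Pred ℕ a) → ∀ n → P n → ∃[ k ] P k × (∀ j → P j → k ≤ j)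
    least P = <-rec (λ n → P n → ∃[ k ] P k × (∀ j → P j → k ≤ j)) step
      where
      step : ∀ n → (∀ {k} → k < n → P k → ∃[ i ] P i × (∀ j → P j → i ≤ j)) →
             P n → ∃[ k ] P k × (∀ j → P j → k ≤ j)
      step n rec pn with em {∃[ k ] k < n × P k}
      ... | yes (k , k<n , pk) = rec k<n pk
      ... | no none = n , pn , λ j pj → ℕₚ.≮⇒≥ λ j<n → none (j , j<n , pj)

  argmin : {A : Set a} (P : Pred A a) (f : A → ℕ) → ∃ P →
           ∃[ x ] x ∈ P × (∀ y → y ∈ P → f x ≤ f y)
  argmin P f (x , px) with least (λ n → ∃[ y ] y ∈ P × f y ≡ n) (f x) (x , px , refl)
  ... | n , (y , py , refl) , low = y , py , λ z pz → low (f z) (z , pz , refl)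

  argmax : {A : Set a} (P : Pred A a) (f : A → ℕ) (b : ℕ) →
           (∀ x → x ∈ P → f x ≤ b) → ∃ P →
           ∃[ x ] x ∈ P × (∀ y → y ∈ P → f y ≤ f x)
  argmax P f b bound nonempty with argmin P (λ x → b ∸ f x) nonempty
  ... | x , px , low = x , px , λ y py →
    subst₂ _≤_ (ℕₚ.m∸[m∸n]≡n (bound y py)) (ℕₚ.m∸[m∸n]≡n (bound x px))
      (ℕₚ.∸-monoʳ-≤ b (low y py))

  private
    shortestWord : ∀ w → ∃[ u ] eval u ≈ w × (∀ v → eval v ≈ w → length u ≤ length v)
    shortestWord w = argmin (λ u → eval u ≈ w) length (generates w)

  -- Some reduced word of w, chosen; by the braid relations satisfied by _⋆_
  -- below, the definition of _*_ does not depend on the choice.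
  reducedWord : Carrier → List S
  reducedWord w = proj₁ (shortestWord w)

  ℓ : Carrier → ℕ
  ℓ w = length (reducedWord w)

  eval-reducedWord : ∀ w → eval (reducedWord w) ≈ w
  eval-reducedWord w = proj₁ (proj₂ (shortestWord w))

  ℓ-minimal : ∀ {w} u → eval u ≈ w → ℓ w ≤ length u
  ℓ-minimal {w} = proj₂ (proj₂ (shortestWord w))

  ℓ-≤ : ∀ {x y} → x ≈ y → ℓ x ≤ ℓ y
  ℓ-≤ {x} {y} x≈y = ℓ-minimal (reducedWord y) (≈-trans (eval-reducedWord y) (≈-sym x≈y))

  Reflection : Pred Carrier a
  Reflection t = ∃[ x ] ∃[ s ] t ≈ x ∙ gen s ∙ x ⁻¹

  _⟶ᴮ_ : Rel Carrier a
  x ⟶ᴮ y = (∃[ t ] t ∈ Reflection × y ≈ x ∙ t) × ℓ x < ℓ y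

  infix 4 _<ᴮ_
  _<ᴮ_ : Rel Carrier a
  _<ᴮ_ = TransClosure _⟶ᴮ_

  BruhatMaximal BruhatMinimal : Pred Carrier a → Pred Carrier a
  BruhatMaximal P x = x ∈ P × (∀ y → y ∈ P → ¬ (x <ᴮ y))
  BruhatMinimal P x = x ∈ P × (∀ y → y ∈ P → ¬ (y <ᴮ x))

  <ᴮ⇒ℓ< : ∀ {x y} → x <ᴮ y → ℓ x < ℓ y
  <ᴮ⇒ℓ< [ _ , x<y ]        = x<y
  <ᴮ⇒ℓ< ((_ , x<y) ∷ y<ᴮz) = ℕₚ.<-trans x<y (<ᴮ⇒ℓ< y<ᴮz)

  infixr 7 _⋆_ _*_

  _⋆_ : S → Carrier → Carrier
  s ⋆ w with ℓ w ℕₚ.<? ℓ (gen s ∙ w)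
  ... | yes _ = gen s ∙ w
  ... | no  _ = w

  _*_ : Carrier → Carrier → Carrier
  x * y = foldr _⋆_ y (reducedWord x)

  -- The subgroup generated by I; generators being involutions, inverses are
  -- not needed.
  ⟨_⟩ : Pred S a → Pred Carrier a
  ⟨ I ⟩ w = ∃[ u ] All (_∈ I) u × eval u ≈ w

  Finite : Pred Carrier a → Set a
  Finite P = ∃[ xs ] (∀ w → w ∈ P → w ∈ₗ xs)

  IsFinitary : Pred S a → Set a
  IsFinitary I = Finite ⟨ I ⟩

  record Finitary : Set (lsuc a) where
    constructor _,_
    field
      set    : Pred S a
      finite : IsFinitary set
  open Finitary public

  private
    ℓ-bounded : (P : Pred Carrier a) → Finite P → ∃[ b ] (∀ w → w ∈ P → ℓ w ≤ b)
    ℓ-bounded P (xs , cover) = foldr _⊔_ 0 (map ℓ xs) , λ w w∈P → bound xs (cover w w∈P)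
      where
      bound : ∀ xs {w} → w ∈ₗ xs → ℓ w ≤ foldr _⊔_ 0 (map ℓ xs)
      bound (x ∷ xs) (here w≈x)   = ℕₚ.≤-trans (ℓ-≤ w≈x) (ℕₚ.m≤m⊔n (ℓ x) _)
      bound (x ∷ xs) (there w∈xs) = ℕₚ.≤-trans (bound xs w∈xs) (ℕₚ.m≤n⊔m (ℓ x) _)

  Longest : Pred Carrier a → Pred Carrier a
  Longest P x = x ∈ P × (∀ y → y ∈ P → ℓ y ≤ ℓ x)

  longest : (I : Finitary) → ∃ (Longest ⟨ set I ⟩)
  longest I =
    let b , bound = ℓ-bounded ⟨ set I ⟩ (finite I)
    in argmax ⟨ set I ⟩ ℓ b bound (ε , [] , [] , ≈-refl)

  -- The longest element is unique, so this depends only on set I.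
  w₀ : Finitary → Carrier
  w₀ I = proj₁ (longest I)

  ℓ₀ : Finitary → ℕ
  ℓ₀ I = ℓ (w₀ I)

  infixl 6 _─_
  _─_ : Finitary → S → Finitary
  K ─ t = (set K ∖ ｛ t ｝) , (proj₁ (finite K) , λ where
    w (u , u∈ , eq) → proj₂ (finite K) w (u , All.map proj₁ u∈ , eq))

  -- An element of W_I \ W / W_J is given by a representative; equality is _≈ᶜ_.
  record Coset (I J : Finitary) : Set a where
    constructor W[_]W
    field
      rep : Carrier
  open Coset public

  module _ {I J : Finitary} where

    ⟦_⟧ : Coset I J → Pred Carrier a
    ⟦ p ⟧ w = ∃[ x ] ∃[ y ] x ∈ ⟨ set I ⟩ × y ∈ ⟨ set J ⟩ × w ≈ x ∙ rep p ∙ y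

    infix 4 _≈ᶜ_
    _≈ᶜ_ : Rel (Coset I J) a
    p ≈ᶜ q = ⟦ p ⟧ ≐ ⟦ q ⟧

    private
      rep∈ : (p : Coset I J) → rep p ∈ ⟦ p ⟧
      rep∈ p = ε , ε , ([] , [] , ≈-refl) , ([] , [] , ≈-refl) ,
        ≈-sym (≈-trans (identityʳ _) (identityˡ _))

      coset-finite : (p : Coset I J) → Finite ⟦ p ⟧
      coset-finite p =
        cartesianProductWith (λ x y → x ∙ rep p ∙ y) (proj₁ (finite I)) (proj₁ (finite J)) ,
        λ where
          w (x , y , x∈ , y∈ , w≈) →
            Membershipₚ.∈-resp-≈ setoid (≈-sym w≈)
              (Membershipₚ.∈-cartesianProductWith⁺ setoid setoid setoid
                (λ eq eq′ → ∙-cong (∙-congʳ eq) eq′)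
                (proj₂ (finite I) x x∈) (proj₂ (finite J) y y∈))

    bruhatMax : (p : Coset I J) → ∃ (BruhatMaximal ⟦ p ⟧)
    bruhatMax p =
      let b , bound = ℓ-bounded ⟦ p ⟧ (coset-finite p)
          x , x∈ , high = argmax ⟦ p ⟧ ℓ b bound (rep p , rep∈ p)
      in x , x∈ , λ y y∈ x<y → ℕₚ.<⇒≱ (<ᴮ⇒ℓ< x<y) (high y y∈)

    bruhatMin : (p : Coset I J) → ∃ (BruhatMinimal ⟦ p ⟧)
    bruhatMin p =
      let x , x∈ , low = argmin ⟦ p ⟧ ℓ (rep p , rep∈ p)
      in x , x∈ , λ y y∈ y<x → ℕₚ.<⇒≱ (<ᴮ⇒ℓ< y<x) (low y y∈)

    -- Maximal and minimal elements of a double coset are unique, so the choices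
    -- made in bruhatMax and bruhatMin are immaterial.
    max min : Coset I J → Carrier
    max p = proj₁ (bruhatMax p)
    min p = proj₁ (bruhatMin p)

  gens : Pred S a → Pred Carrier a
  gens I w = ∃[ s ] s ∈ I × w ≈ gen s

  conjugate : Carrier → Pred Carrier a → Pred Carrier a
  conjugate x P w = ∃[ y ] y ∈ P × w ≈ x ∙ y ∙ x ⁻¹

  Core : ∀ {I J} → Coset I J → Set a
  Core {I} {J} p = gens (set I) ≐ conjugate (min p) (gens (set J))

  infixl 7 _*ᶜ_
  _*ᶜ_ : ∀ {I J K} → Coset I J → Coset J K → Coset I K
  p *ᶜ q = W[ max p * max q ]W

  ReducedComposition : ∀ {I J K} → Coset I J → Coset J K → Set a
  ReducedComposition {J = J} p q =
    max p * max q ≈ max p ∙ w₀ J ⁻¹ ∙ max q ×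
    + ℓ (max p * max q) ≡ + ℓ (max p) ℤ.- + ℓ₀ J ℤ.+ + ℓ (max q)

  -- A sequence [ I = L₀ , … , L_d = J ].  Subsets are compared by _≐_, so the
  -- last term is only required to be extensionally equal to J.
  data Expression : Finitary → Finitary → Set (lsuc a) where
    stop   : ∀ {I J} → set I ≐ set J → Expression I J
    add    : ∀ {I K J} s → s ∉ set I → set K ≐ set I ∪ ｛ s ｝ →
             Expression K J → Expression I J
    remove : ∀ {I K J} t → t ∈ set I → set K ≐ set I ∖ ｛ t ｝ →
             Expression K J → Expression I J

  terms : ∀ {I J} → Expression I J → List Finitary
  terms {I} (stop _)         = I ∷ []
  terms {I} (add _ _ _ e)    = I ∷ terms e
  terms {I} (remove _ _ _ e) = I ∷ terms e

  infix 4 _≋_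
  _≋_ : ∀ {I J} → Rel (Expression I J) (lsuc a)
  e ≋ e′ = Pointwise (λ K L → set K ≐ set L) (terms e) (terms e′)

  -- Grouping into I ⊂ K₁ ⊃ I₁ ⊂ K₂ ⊃ ⋯ ⊂ Kₘ ⊃ Iₘ = J, recorded as K₁ together
  -- with the pairs (I₁ , K₂), …, (Iₘ₋₁ , Kₘ).  ascend reads the rest of an
  -- expression within a run of additions, descend within a run of removals.
  Grouping : Set (lsuc a)
  Grouping = Finitary × List (Finitary × Finitary)

  ascend  : ∀ {I J} → Expression I J → Grouping
  descend : ∀ {I J} → Expression I J → List (Finitary × Finitary)

  ascend {I} (stop _)         = I , []
  ascend     (add _ _ _ e)    = ascend e
  ascend {I} (remove _ _ _ e) = I , descend e

  descend     (stop _)         = []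
  descend {I} (add _ _ _ e)    = let K , rest = ascend e in (I , K) ∷ rest
  descend     (remove _ _ _ e) = descend e

  group : ∀ {I J} → Expression I J → Grouping
  group = ascend

  value : Grouping → Carrier
  value (K₁ , rest) = w₀ K₁ ∙ foldr (λ (I , K) x → w₀ I ⁻¹ ∙ w₀ K ∙ x) ε rest

  alternatingLength : Grouping → ℤ
  alternatingLength (K₁ , rest) =
    + ℓ₀ K₁ ℤ.+ foldr (λ (I , K) n → ℤ.- (+ ℓ₀ I) ℤ.+ + ℓ₀ K ℤ.+ n) (+ 0) rest

  ReducedExpression : ∀ {I J} → Coset I J → Expression I J → Set a
  ReducedExpression p e =
    max p ≈ value (group e) × + ℓ (max p) ≡ alternatingLength (group e)

  UniqueReducedExpression : ∀ {I J} → Coset I J → Expression I J → Set (lsuc a)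
  UniqueReducedExpression p e =
    ReducedExpression p e × (∀ e′ → ReducedExpression p e′ → e′ ≋ e)

{-# OPTIONS --safe #-}
-- The parity of the number of times t occurs among the reflections of a word is unchanged by
-- deleting a Coxeter relator, which gives the exchange condition and with it lengths in W_I z.
-- A core coset r with minimal element x is W_I x, with maximal element y = w_I x.  If x ≠ 1,
-- a left descent s of x is also one of y, so K = I ∪ {s} consists of descents of y; hence K
-- is finitary and y = w_K z with z minimal in W_K z.  Put L = K ∖ {t} with t = w_K s w_K;
-- then W_I w_K W_L and W_L z W_J are core cosets composing to r.
-- A reduced expression for w_K that passes from I to L has its first peak inside K.  It cannot
-- begin with a removal, for then the rest of it would be lengthened by a generator of L on the
-- right; so it reaches K at once, and its length leaves room only for the removal of t.
module Submission where

open import Algebra.Bundles using (Group)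
import Algebra.Definitions.RawMonoid
import Algebra.Properties.Group
import Algebra.Properties.Monoid.Mult
open import Axiom.ExcludedMiddle using (ExcludedMiddle)
open import Data.Bool.Base using (Bool; true; false; not; _xor_)
import Data.Bool.Properties as Boolₚ
open import Data.Empty using (⊥; ⊥-elim)
open import Data.Fin.Base using (Fin)
import Data.Fin.Properties as Finₚ
open import Data.Integer.Base as ℤ using (+_)
import Data.Integer.Properties as ℤₚ
import Data.Integer.Solver as ℤSolver
open import Data.List.Base
  using (List; []; _∷_; _++_; length; foldr; concat; replicate; cartesianProductWith)
import Data.List.Membership.Setoid.Properties as Membershipₚ
import Data.List.Properties as Listₚ
open import Data.List.Relation.Binary.Pointwise using (Pointwise; []; _∷_)
open import Data.List.Relation.Unary.All as All using (All; []; _∷_)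
import Data.List.Relation.Unary.All.Properties as Allₚ
open import Data.List.Relation.Unary.Any using (here; there)
open import Data.Maybe.Base using (Maybe; just; nothing)
open import Data.Nat.Base using (ℕ; zero; suc; _+_; _∸_; _≤_; _<_; z≤n; s≤s)
open import Data.Nat.Divisibility using (∣-refl; ∣⇒≤)
import Data.Nat.Properties as ℕₚ
import Data.Nat.Solver as ℕSolver
open import Data.Product.Base using (Σ-syntax; ∃-syntax; _×_; _,_; proj₁; proj₂)
open import Data.Sum.Base using (_⊎_; inj₁; inj₂)
import Data.Sum.Base as Sum
open import Data.Vec.Base using (Vec; []; _∷_; lookup; allFin; map)
open import Data.Vec.N-ary using (N-ary; _$ⁿ_)
open import Function.Base using (_∘_)
open import Function.Bundles using (Equivalence; mk⇔)
open import Level using (Level; _⊔_) renaming (suc to lsuc)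
open import Relation.Binary.Construct.Closure.Equivalence using (gfold)
open import Relation.Binary.Construct.Closure.Transitive using ([_])
open import Relation.Binary.PropositionalEquality as ≡
  using (_≡_; refl; cong; cong₂; subst; subst₂)
import Relation.Binary.Reasoning.Setoid
open import Relation.Nullary.Decidable using (yes; no; does; does-⇔; decidable-stable)
open import Relation.Nullary.Negation using (¬_; contradiction)
open import Relation.Unary using (Pred; _∈_; _∉_; _⊆_; _≐_; _∪_; ｛_｝)
open import Relation.Unary.Properties using (≐-refl)
open import Defs

-- Lengths are minimal lengths of words, and equality in W is known only through deletions of
-- relators. A lower bound on a length therefore calls for a quantity defined on words and invariant
-- under deletion. The reflection parity `inv` is such a quantity, and its cocycle rule turns a
-- descent of a product into a reflection that shortens one of the factors. Since W_I x W_J = W_I x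
-- for a core coset, left descents suffice to recognise its extremal elements. Descents are taken of
-- y rather than of x because x has none in I, and because nothing says beforehand that I ∪ {s}
-- generates a finite group. An element whose descents include all of K has every element of W_K as
-- a prefix of a reduced word, which bounds the lengths in W_K. `_*_` is computed from an
-- unspecified reduced word. Its value is pinned down by length: the product stays in W_K z and
-- begins with w_K, so it can only be w_K z.

-- Free reduction of words, in which atoms known to be involutions are their own inverses.
module GroupSolver {c ℓ} (G : Group c ℓ) where

  open Group G
  open Algebra.Properties.Group G using (⁻¹-anti-homo-∙; ε⁻¹≈ε; ⁻¹-involutive; inverseˡ-unique)
  open Relation.Binary.Reasoning.Setoid setoid

  data Atom : Set (c ⊔ ℓ) where
    free       : Carrier → Atom
    involution : ∀ x → x ∙ x ≈ ε → Atom

  infixr 7 _⊕_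
  infix 8 ⊖_

  data Expr (n : ℕ) : Set where
    var : Fin n → Expr n
    id  : Expr n
    _⊕_ : Expr n → Expr n → Expr n
    ⊖_  : Expr n → Expr n

  atom : Atom → Carrier
  atom (free x)         = x
  atom (involution x _) = x

  module _ {n : ℕ} (ρ : Vec Atom n) where

    ⟦_⟧ₑ : Expr n → Carrier
    ⟦ var i ⟧ₑ = atom (lookup ρ i)
    ⟦ id ⟧ₑ    = ε
    ⟦ x ⊕ y ⟧ₑ = ⟦ x ⟧ₑ ∙ ⟦ y ⟧ₑ
    ⟦ ⊖ x ⟧ₑ   = ⟦ x ⟧ₑ ⁻¹

    -- true marks an inverted atom
    Letter : Set
    Letter = Fin n × Bool

    letter : Letter → Carrier
    letter (i , false) = atom (lookup ρ i)
    letter (i , true)  = atom (lookup ρ i) ⁻¹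

    word : List Letter → Carrier
    word []      = ε
    word (l ∷ w) = letter l ∙ word w

    inverted : Fin n → Letter
    inverted i with lookup ρ i
    ... | free _         = i , true
    ... | involution _ _ = i , false

    letter-inverted : ∀ i → letter (inverted i) ≈ atom (lookup ρ i) ⁻¹
    letter-inverted i with lookup ρ i in eq
    ... | free _          rewrite eq = Group.refl G
    ... | involution x xx rewrite eq = inverseˡ-unique x x xx

    cancel : (l l′ : Letter) → Maybe (letter l ∙ letter l′ ≈ ε)
    cancel (i , b) (j , b′) with i Finₚ.≟ j
    ... | no _ = nothing
    cancel (i , false) (i , true)  | yes refl = just (inverseʳ _)
    cancel (i , true)  (i , false) | yes refl = just (inverseˡ _)
    cancel (i , true)  (i , true)  | yes refl = nothing
    cancel (i , false) (i , false) | yes refl with lookup ρ i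
    ... | free _          = nothing
    ... | involution _ xx = just xx

    cons : Letter → List Letter → List Letter
    cons l []       = l ∷ []
    cons l (l′ ∷ w) with cancel l l′
    ... | just _  = w
    ... | nothing = l ∷ l′ ∷ w

    cons-sound : ∀ l w → word (cons l w) ≈ letter l ∙ word w
    cons-sound l []       = Group.refl G
    cons-sound l (l′ ∷ w) with cancel l l′
    ... | nothing = Group.refl G
    ... | just eq = begin
      word w                          ≈⟨ identityˡ _ ⟨
      ε ∙ word w                      ≈⟨ ∙-congʳ eq ⟨
      letter l ∙ letter l′ ∙ word w   ≈⟨ assoc _ _ _ ⟩
      letter l ∙ (letter l′ ∙ word w) ∎

    reduce reduce⁻¹ : Expr n → List Letter → List Letter
    reduce (var i) w = cons (i , false) w
    reduce id      w = w
    reduce (x ⊕ y) w = reduce x (reduce y w)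
    reduce (⊖ x)   w = reduce⁻¹ x w
    reduce⁻¹ (var i) w = cons (inverted i) w
    reduce⁻¹ id      w = w
    reduce⁻¹ (x ⊕ y) w = reduce⁻¹ y (reduce⁻¹ x w)
    reduce⁻¹ (⊖ x)   w = reduce x w

    sound   : ∀ x w → word (reduce x w) ≈ ⟦ x ⟧ₑ ∙ word w
    sound⁻¹ : ∀ x w → word (reduce⁻¹ x w) ≈ ⟦ x ⟧ₑ ⁻¹ ∙ word w
    sound (var i) w = cons-sound _ w
    sound id      w = sym (identityˡ _)
    sound (x ⊕ y) w = begin
      word (reduce x (reduce y w))  ≈⟨ sound x _ ⟩
      ⟦ x ⟧ₑ ∙ word (reduce y w)    ≈⟨ ∙-congˡ (sound y w) ⟩
      ⟦ x ⟧ₑ ∙ (⟦ y ⟧ₑ ∙ word w)    ≈⟨ assoc _ _ _ ⟨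
      ⟦ x ⟧ₑ ∙ ⟦ y ⟧ₑ ∙ word w      ∎
    sound (⊖ x)   w = sound⁻¹ x w
    sound⁻¹ (var i) w = trans (cons-sound (inverted i) w) (∙-congʳ (letter-inverted i))
    sound⁻¹ id      w = sym (trans (∙-congʳ ε⁻¹≈ε) (identityˡ _))
    sound⁻¹ (x ⊕ y) w = begin
      word (reduce⁻¹ y (reduce⁻¹ x w))   ≈⟨ sound⁻¹ y _ ⟩
      ⟦ y ⟧ₑ ⁻¹ ∙ word (reduce⁻¹ x w)    ≈⟨ ∙-congˡ (sound⁻¹ x w) ⟩
      ⟦ y ⟧ₑ ⁻¹ ∙ (⟦ x ⟧ₑ ⁻¹ ∙ word w)   ≈⟨ assoc _ _ _ ⟨
      ⟦ y ⟧ₑ ⁻¹ ∙ ⟦ x ⟧ₑ ⁻¹ ∙ word w     ≈⟨ ∙-congʳ (⁻¹-anti-homo-∙ _ _) ⟨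
      (⟦ x ⟧ₑ ∙ ⟦ y ⟧ₑ) ⁻¹ ∙ word w      ∎
    sound⁻¹ (⊖ x)   w = trans (sound x w) (∙-congʳ (sym (⁻¹-involutive _)))

    -- The normal forms agree by `refl` in every use: cancellation is decided from the indices and
    -- the constructors of the atoms, never by comparing group elements.
    solve : (f : N-ary n (Expr n) (Expr n × Expr n)) →
            let l , r = f $ⁿ map var (allFin n) in
            reduce l [] ≡ reduce r [] → ⟦ l ⟧ₑ ≈ ⟦ r ⟧ₑ
    solve f eq = begin
      ⟦ l ⟧ₑ              ≈⟨ identityʳ _ ⟨
      ⟦ l ⟧ₑ ∙ ε          ≈⟨ sound l [] ⟨
      word (reduce l [])  ≈⟨ reflexive (cong word eq) ⟩
      word (reduce r [])  ≈⟨ sound r [] ⟩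
      ⟦ r ⟧ₑ ∙ ε          ≈⟨ identityʳ _ ⟩
      ⟦ r ⟧ₑ              ∎
      where
      l = proj₁ (f $ⁿ map var (allFin n))
      r = proj₂ (f $ⁿ map var (allFin n))

-- Sums modulo 2

xorSum : (ℕ → Bool) → ℕ → Bool
xorSum f zero    = false
xorSum f (suc n) = f 0 xor xorSum (f ∘ suc) n

xorSum-cong : ∀ {f g} → (∀ i → f i ≡ g i) → ∀ n → xorSum f n ≡ xorSum g n
xorSum-cong f≗g zero    = refl
xorSum-cong f≗g (suc n) = cong₂ _xor_ (f≗g 0) (xorSum-cong (f≗g ∘ suc) n)

xorSum-+ : ∀ f n k → xorSum f (n + k) ≡ xorSum f n xor xorSum (λ i → f (n + i)) k
xorSum-+ f zero    k = refl
xorSum-+ f (suc n) k = ≡.trans (cong (f 0 xor_) (xorSum-+ (f ∘ suc) n k))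
  (≡.sym (Boolₚ.xor-assoc (f 0) _ _))

-- Every value of the first period recurs in the second, and the two cancel modulo 2.
xorSum-periodic : ∀ f n → (∀ i → f (n + i) ≡ f i) → xorSum f (n + n) ≡ false
xorSum-periodic f n periodic = begin
  xorSum f (n + n)                            ≡⟨ xorSum-+ f n n ⟩
  xorSum f n xor xorSum (λ i → f (n + i)) n   ≡⟨ cong (xorSum f n xor_) (xorSum-cong periodic n) ⟩
  xorSum f n xor xorSum f n                   ≡⟨ Boolₚ.xor-same (xorSum f n) ⟩
  false                                       ∎
  where open ≡.≡-Reasoning

module CoxeterCosets {a} (em : ExcludedMiddle a) (𝒲 : CoxeterSystem a) where

  open Cosets em 𝒲
  open Algebra.Properties.Group W using (ε⁻¹≈ε; ⁻¹-involutive)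
  open GroupSolver W hiding (word; letter; cons; cancel)
  open Algebra.Definitions.RawMonoid rawMonoid using () renaming (_×_ to _·_)
  open Algebra.Properties.Monoid.Mult monoid using (×-homo-+; ×-homo-1)
  module ≈-Reasoning = Relation.Binary.Reasoning.Setoid setoid

  -- The reflection parity of words

  gen² : ∀ s → gen s ∙ gen s ≈ ε
  gen² s = ≈-trans (∙-congˡ (≈-sym (identityʳ _))) (Equivalence.from (gen-order s 2) ∣-refl)

  ⟪_⟫ : S → Atom
  ⟪ s ⟫ = involution (gen s) (gen² s)

  eval-++ : ∀ u v → eval (u ++ v) ≈ eval u ∙ eval v
  eval-++ []      v = ≈-sym (identityˡ _)
  eval-++ (s ∷ u) v = ≈-trans (∙-congˡ (eval-++ u v)) (≈-sym (assoc _ _ _))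

  test : Carrier → Carrier → Bool
  test x y = does (em {x ≈ y})

  test-⇔ : ∀ {x y x′ y′} → (x ≈ y → x′ ≈ y′) → (x′ ≈ y′ → x ≈ y) → test x y ≡ test x′ y′
  test-⇔ to from = does-⇔ (mk⇔ to from) em em

  -- The parity of the number of indices i with t = s₁⋯sᵢ₋₁sᵢsᵢ₋₁⋯s₁, where u = s₁⋯sₙ.
  inv : List S → Carrier → Bool
  inv []      t = false
  inv (s ∷ u) t = test t (gen s) xor inv u (gen s ∙ t ∙ gen s)

  inv-cong : ∀ u {t t′} → t ≈ t′ → inv u t ≡ inv u t′
  inv-cong []      eq = refl
  inv-cong (s ∷ u) eq = cong₂ _xor_
    (test-⇔ (≈-trans (≈-sym eq)) (≈-trans eq)) (inv-cong u (∙-congʳ (∙-congˡ eq)))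

  -- The reflections of `u ++ v` are those of u, then those of v conjugated by `eval u`. Conjugating
  -- t backwards instead gives a cocycle rule.
  inv-++ : ∀ u v t → inv (u ++ v) t ≡ inv u t xor inv v (eval u ⁻¹ ∙ t ∙ eval u)
  inv-++ []      v t = inv-cong v (solve (free t ∷ []) (λ t → t , (⊖ id ⊕ t) ⊕ id) refl)
  inv-++ (s ∷ u) v t = begin
    test t (gen s) xor inv (u ++ v) t′
      ≡⟨ cong (test t (gen s) xor_) (inv-++ u v t′) ⟩
    test t (gen s) xor (inv u t′ xor inv v (eval u ⁻¹ ∙ t′ ∙ eval u))
      ≡⟨ Boolₚ.xor-assoc (test t (gen s)) _ _ ⟨
    (test t (gen s) xor inv u t′) xor inv v (eval u ⁻¹ ∙ t′ ∙ eval u)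
      ≡⟨ cong (inv (s ∷ u) t xor_) (inv-cong v (solve (⟪ s ⟫ ∷ free t ∷ free (eval u) ∷ [])
           (λ s t u → (⊖ u ⊕ ((s ⊕ t) ⊕ s)) ⊕ u , (⊖ (s ⊕ u) ⊕ t) ⊕ (s ⊕ u)) refl)) ⟩
    inv (s ∷ u) t xor inv v ((gen s ∙ eval u) ⁻¹ ∙ t ∙ (gen s ∙ eval u)) ∎
    where
    open ≡.≡-Reasoning
    t′ = gen s ∙ t ∙ gen s

  relator : S → S → ℕ → List S
  relator s t k = concat (replicate k (s ∷ t ∷ []))

  eval-relator : ∀ s t k → eval (relator s t k) ≈ k · (gen s ∙ gen t)
  eval-relator s t zero    = ≈-refl
  eval-relator s t (suc k) = ≈-trans (≈-sym (assoc _ _ _)) (∙-congˡ (eval-relator s t k))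

  ·-comm : ∀ x k → x ∙ k · x ≈ k · x ∙ x
  ·-comm x k = begin
    x ∙ k · x       ≡⟨⟩
    (1 + k) · x     ≡⟨ cong (_· x) (ℕₚ.+-comm 1 k) ⟩
    (k + 1) · x     ≈⟨ ×-homo-+ x k 1 ⟩
    k · x ∙ 1 · x   ≈⟨ ∙-congˡ (×-homo-1 x) ⟩
    k · x ∙ x       ∎
    where open ≈-Reasoning

  module _ (s t : S) where
    private
      c = gen s ∙ gen t

    -- The reflections of the word (s t)ᵏ are cⁱ s for i < 2k, where c = s t.
    hit : Carrier → ℕ → Bool
    hit x i = test x (i · c ∙ gen s)

    -- Passing two letters of (s t)ᵏ replaces x by c⁻¹ x c. As s inverts c by conjugation, this
    -- lowers the exponent in cⁱ s by two.
    hit-shift : ∀ x i → hit x (2 + i) ≡ hit (gen t ∙ (gen s ∙ x ∙ gen s) ∙ gen t) i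
    hit-shift x i = test-⇔ to from
      where
      open ≈-Reasoning
      cⁱ = i · c
      shifted : c ∙ cⁱ ∙ c ∙ gen s ≈ (2 + i) · c ∙ gen s
      shifted = ∙-congʳ (≈-trans (assoc _ _ _) (∙-congˡ (≈-sym (·-comm c i))))
      to : x ≈ (2 + i) · c ∙ gen s → gen t ∙ (gen s ∙ x ∙ gen s) ∙ gen t ≈ cⁱ ∙ gen s
      to eq = begin
        gen t ∙ (gen s ∙ x ∙ gen s) ∙ gen t
          ≈⟨ ∙-congʳ (∙-congˡ (∙-congʳ (∙-congˡ (≈-trans eq (≈-sym shifted))))) ⟩
        gen t ∙ (gen s ∙ (c ∙ cⁱ ∙ c ∙ gen s) ∙ gen s) ∙ gen t
          ≈⟨ solve (⟪ s ⟫ ∷ ⟪ t ⟫ ∷ free cⁱ ∷ []) (λ s t y →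
               (t ⊕ ((s ⊕ ((((s ⊕ t) ⊕ y) ⊕ (s ⊕ t)) ⊕ s)) ⊕ s)) ⊕ t , y ⊕ s) refl ⟩
        cⁱ ∙ gen s ∎
      from : gen t ∙ (gen s ∙ x ∙ gen s) ∙ gen t ≈ cⁱ ∙ gen s → x ≈ (2 + i) · c ∙ gen s
      from eq = begin
        x
          ≈⟨ solve (⟪ s ⟫ ∷ ⟪ t ⟫ ∷ free x ∷ []) (λ s t x → x ,
               ((s ⊕ t) ⊕ ((t ⊕ ((s ⊕ x) ⊕ s)) ⊕ t)) ⊕ (t ⊕ s)) refl ⟩
        c ∙ (gen t ∙ (gen s ∙ x ∙ gen s) ∙ gen t) ∙ (gen t ∙ gen s)
          ≈⟨ ∙-congʳ (∙-congˡ eq) ⟩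
        c ∙ (cⁱ ∙ gen s) ∙ (gen t ∙ gen s)
          ≈⟨ solve (⟪ s ⟫ ∷ ⟪ t ⟫ ∷ free cⁱ ∷ []) (λ s t y →
               ((s ⊕ t) ⊕ (y ⊕ s)) ⊕ (t ⊕ s) , (((s ⊕ t) ⊕ y) ⊕ (s ⊕ t)) ⊕ s) refl ⟩
        c ∙ cⁱ ∙ c ∙ gen s
          ≈⟨ shifted ⟩
        (2 + i) · c ∙ gen s ∎

    inv-relator : ∀ k x → inv (relator s t k) x ≡ xorSum (hit x) (k + k)
    inv-relator zero    x = refl
    inv-relator (suc k) x rewrite ℕₚ.+-suc k k = cong₂ _xor_
      (test-⇔ (λ eq → ≈-trans eq (≈-sym (identityˡ _))) (λ eq → ≈-trans eq (identityˡ _)))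
      (cong₂ _xor_
        (test-⇔
          (λ eq → ≈-trans (solve (⟪ s ⟫ ∷ free x ∷ []) (λ s x → x , s ⊕ (((s ⊕ x) ⊕ s) ⊕ s)) refl)
                  (≈-trans (∙-congˡ (∙-congʳ eq))
                  (solve (⟪ s ⟫ ∷ ⟪ t ⟫ ∷ []) (λ s t → s ⊕ (t ⊕ s) , ((s ⊕ t) ⊕ id) ⊕ s) refl)))
          (λ eq → ≈-trans (∙-congʳ (∙-congˡ eq))
                  (solve (⟪ s ⟫ ∷ ⟪ t ⟫ ∷ []) (λ s t → (s ⊕ (((s ⊕ t) ⊕ id) ⊕ s)) ⊕ s , t) refl)))
        (≡.trans (inv-relator k _) (xorSum-cong (λ i → ≡.sym (hit-shift x i)) (k + k))))

    relator-order : m s t · c ≈ ε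
    relator-order = Equivalence.from (m-order s t (m s t)) ∣-refl

    -- The relator has 2m reflections, and cᵐ = 1 makes them run through the same m values twice.
    -- For infinite order, m = 0 and the sum is empty.
    inv-relator-false : ∀ x → inv (relator s t (m s t)) x ≡ false
    inv-relator-false x = ≡.trans (inv-relator (m s t) x)
      (xorSum-periodic (hit x) (m s t) λ i →
        test-⇔ (λ eq → ≈-trans eq (period i)) (λ eq → ≈-trans eq (≈-sym (period i))))
      where
      period : ∀ i → (m s t + i) · c ∙ gen s ≈ i · c ∙ gen s
      period i = ∙-congʳ (≈-trans (×-homo-+ c (m s t) i)
        (≈-trans (∙-congʳ relator-order) (identityˡ _)))

  inv-deletes : ∀ x {u v} → Deletes m u v → inv u x ≡ inv v x
  inv-deletes x (delete u s t v) = begin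
    inv (u ++ r ++ v) x
      ≡⟨ inv-++ u (r ++ v) x ⟩
    inv u x xor inv (r ++ v) y
      ≡⟨ cong (inv u x xor_) (inv-++ r v y) ⟩
    inv u x xor (inv r y xor inv v (eval r ⁻¹ ∙ y ∙ eval r))
      ≡⟨ cong (inv u x xor_) (cong₂ _xor_ (inv-relator-false s t y) (inv-cong v r≈)) ⟩
    inv u x xor inv v y
      ≡⟨ inv-++ u v x ⟨
    inv (u ++ v) x ∎
    where
    open ≡.≡-Reasoning
    r = relator s t (m s t)
    y = eval u ⁻¹ ∙ x ∙ eval u
    r≈ε : eval r ≈ ε
    r≈ε = ≈-trans (eval-relator s t (m s t)) (relator-order s t)
    r≈ : eval r ⁻¹ ∙ y ∙ eval r ≈ y
    r≈ = ≈-trans (∙-cong (∙-congʳ (⁻¹-cong r≈ε)) r≈ε)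
      (solve (free y ∷ []) (λ y → (⊖ id ⊕ y) ⊕ id , y) refl)

  -- This is where the presentation enters: words with equal value are linked by deletions, so the
  -- parity depends only on the element of W.
  inv-invariant : ∀ u v → eval u ≈ eval v → ∀ x → inv u x ≡ inv v x
  inv-invariant u v eq x =
    gfold ≡.isEquivalence (λ u → inv u x) (inv-deletes x) {u} {v} (presented {u} {v} eq)

  -- An odd count is not zero, so t is the reflection of some letter, and multiplying by it on the
  -- left deletes that letter.
  inv-exchange : ∀ u t → inv u t ≡ true →
                 ∃[ x ] ∃[ k ] ∃[ y ] u ≡ x ++ k ∷ y × t ∙ eval u ≈ eval (x ++ y)
  inv-exchange (s ∷ u) t odd with em {t ≈ gen s}
  ... | yes t≈s = [] , s , u , refl ,
    ≈-trans (∙-congʳ t≈s) (solve (⟪ s ⟫ ∷ free (eval u) ∷ []) (λ s u → s ⊕ (s ⊕ u) , u) refl)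
  ... | no _ with inv-exchange u _ odd
  ...   | x , k , y , refl , eq = s ∷ x , k , y , refl ,
    ≈-trans (solve (⟪ s ⟫ ∷ free t ∷ free (eval u) ∷ [])
      (λ s t u → t ⊕ (s ⊕ u) , s ⊕ (((s ⊕ t) ⊕ s) ⊕ u)) refl) (∙-congˡ eq)

  inv-own : ∀ s u → inv (s ∷ u) (gen s) ≡ not (inv u (gen s))
  inv-own s u with em {gen s ≈ gen s}
  ... | no ≉ = ⊥-elim (≉ ≈-refl)
  ... | yes _ = cong not (inv-cong u (solve (⟪ s ⟫ ∷ []) (λ s → (s ⊕ s) ⊕ s , s) refl))

  -- Lengths and the exchange condition

  ℓ-cong : ∀ {x y} → x ≈ y → ℓ x ≡ ℓ y
  ℓ-cong eq = ℕₚ.≤-antisym (ℓ-≤ eq) (ℓ-≤ (≈-sym eq))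

  ℓ-∙ : ∀ x y → ℓ (x ∙ y) ≤ ℓ x + ℓ y
  ℓ-∙ x y = subst (ℓ (x ∙ y) ≤_) (Listₚ.length-++ (reducedWord x))
    (ℓ-minimal (reducedWord x ++ reducedWord y)
      (≈-trans (eval-++ (reducedWord x) _) (∙-cong (eval-reducedWord x) (eval-reducedWord y))))

  ℓ-ε : ℓ ε ≡ 0
  ℓ-ε = ℕₚ.n≤0⇒n≡0 (ℓ-minimal [] ≈-refl)

  ℓ≡0⇒≈ε : ∀ {x} → ℓ x ≡ 0 → x ≈ ε
  ℓ≡0⇒≈ε {x} eq with reducedWord x | eval-reducedWord x
  ... | [] | ev = ≈-sym ev

  ℓ-gen≤1 : ∀ s → ℓ (gen s) ≤ 1
  ℓ-gen≤1 s = ℓ-minimal (s ∷ []) (identityʳ _)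

  ℓ-gen∙ : ∀ s w → ℓ (gen s ∙ w) ≤ suc (ℓ w)
  ℓ-gen∙ s w = ℕₚ.≤-trans (ℓ-∙ _ _) (ℕₚ.+-monoˡ-≤ (ℓ w) (ℓ-gen≤1 s))

  gen-gen : ∀ s w → gen s ∙ (gen s ∙ w) ≈ w
  gen-gen s w = solve (⟪ s ⟫ ∷ free w ∷ []) (λ s w → s ⊕ (s ⊕ w) , w) refl

  ℓ-gen∙′ : ∀ s w → ℓ w ≤ suc (ℓ (gen s ∙ w))
  ℓ-gen∙′ s w = subst (_≤ suc (ℓ (gen s ∙ w))) (ℓ-cong (gen-gen s w)) (ℓ-gen∙ s (gen s ∙ w))

  Inv : Carrier → Carrier → Bool
  Inv w t = inv (reducedWord w) t

  Inv-eval : ∀ u t → Inv (eval u) t ≡ inv u t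
  Inv-eval u t = inv-invariant (reducedWord (eval u)) u (eval-reducedWord (eval u)) t

  Inv-cong : ∀ {w w′} t → w ≈ w′ → Inv w t ≡ Inv w′ t
  Inv-cong {w} {w′} t eq = inv-invariant (reducedWord w) (reducedWord w′)
    (≈-trans (eval-reducedWord _) (≈-trans eq (≈-sym (eval-reducedWord _)))) t

  -- If s lengthens x, a descent s of x y becomes the reflection x⁻¹ s x, which shortens y. The
  -- additivity of lengths in `≼-step` and `minimal⇒ℓ` rests on this.
  Inv-∙ : ∀ x y t → Inv (x ∙ y) t ≡ Inv x t xor Inv y (x ⁻¹ ∙ t ∙ x)
  Inv-∙ x y t = begin
    Inv (x ∙ y) t
      ≡⟨ inv-invariant (reducedWord (x ∙ y)) (u ++ reducedWord y) (≈-trans (eval-reducedWord _)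
           (≈-trans (≈-sym (∙-cong ux uy)) (≈-sym (eval-++ u (reducedWord y))))) t ⟩
    inv (u ++ reducedWord y) t
      ≡⟨ inv-++ u _ t ⟩
    Inv x t xor Inv y (eval u ⁻¹ ∙ t ∙ eval u)
      ≡⟨ cong (Inv x t xor_) (inv-cong (reducedWord y) (∙-cong (∙-congʳ (⁻¹-cong ux)) ux)) ⟩
    Inv x t xor Inv y (x ⁻¹ ∙ t ∙ x) ∎
    where
    open ≡.≡-Reasoning
    u = reducedWord x
    ux = eval-reducedWord x
    uy = eval-reducedWord y

  length-delete : ∀ (x : List S) k y → length (x ++ k ∷ y) ≡ suc (length (x ++ y))
  length-delete []      k y = refl
  length-delete (_ ∷ x) k y = cong suc (length-delete x k y)

  Inv⇒shorter : ∀ w t → Inv w t ≡ true → ℓ (t ∙ w) < ℓ w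
  Inv⇒shorter w t odd with inv-exchange (reducedWord w) t odd
  ... | x , k , y , eq , ev = begin-strict
    ℓ (t ∙ w)                <⟨ s≤s (ℓ-minimal (x ++ y)
                                  (≈-trans (≈-sym ev) (∙-congˡ (eval-reducedWord w)))) ⟩
    suc (length (x ++ y))    ≡⟨ length-delete x k y ⟨
    length (x ++ k ∷ y)      ≡⟨ cong length eq ⟨
    ℓ w                      ∎
    where open ℕₚ.≤-Reasoning

  Inv-gen∙ : ∀ s w → Inv (gen s ∙ w) (gen s) ≡ not (Inv w (gen s))
  Inv-gen∙ s w = ≡.trans (inv-invariant (reducedWord (gen s ∙ w)) (s ∷ reducedWord w)
      (≈-trans (eval-reducedWord _) (∙-congˡ (≈-sym (eval-reducedWord w)))) (gen s))
    (inv-own s (reducedWord w))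

  -- The parity at s toggles when s is prefixed, so s shortens `gen s ∙ w`, which leads back to w.
  ¬Inv⇒longer : ∀ w s → Inv w (gen s) ≡ false → ℓ w < ℓ (gen s ∙ w)
  ¬Inv⇒longer w s even = subst (_< ℓ (gen s ∙ w)) (ℓ-cong (gen-gen s w))
    (Inv⇒shorter (gen s ∙ w) (gen s) (≡.trans (Inv-gen∙ s w) (cong not even)))

  shorter⇒Inv : ∀ w s → ℓ (gen s ∙ w) < ℓ w → Inv w (gen s) ≡ true
  shorter⇒Inv w s lt with Inv w (gen s) in eq
  ... | true  = refl
  ... | false = ⊥-elim (ℕₚ.<-asym lt (¬Inv⇒longer w s eq))

  longer⇒¬Inv : ∀ w s → ℓ w < ℓ (gen s ∙ w) → Inv w (gen s) ≡ false
  longer⇒¬Inv w s lt with Inv w (gen s) in eq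
  ... | false = refl
  ... | true  = ⊥-elim (ℕₚ.<-asym lt (Inv⇒shorter w (gen s) eq))

  shorter⊎longer : ∀ s w → ℓ (gen s ∙ w) < ℓ w ⊎ ℓ w < ℓ (gen s ∙ w)
  shorter⊎longer s w with Inv w (gen s) in eq
  ... | true  = inj₁ (Inv⇒shorter w (gen s) eq)
  ... | false = inj₂ (¬Inv⇒longer w s eq)

  ℓ-longer : ∀ s w → ℓ w < ℓ (gen s ∙ w) → ℓ (gen s ∙ w) ≡ suc (ℓ w)
  ℓ-longer s w lt = ℕₚ.≤-antisym (ℓ-gen∙ s w) lt

  exchange : ∀ u s → ℓ (gen s ∙ eval u) < ℓ (eval u) →
             ∃[ x ] ∃[ k ] ∃[ y ] u ≡ x ++ k ∷ y × gen s ∙ eval u ≈ eval (x ++ y)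
  exchange u s lt = inv-exchange u (gen s)
    (≡.trans (≡.sym (Inv-eval u (gen s))) (shorter⇒Inv (eval u) s lt))

  ℓ-⁻¹ : ∀ w → ℓ (w ⁻¹) ≡ ℓ w
  ℓ-⁻¹ w = ℕₚ.≤-antisym (le w) (subst (_≤ ℓ (w ⁻¹)) (ℓ-cong (⁻¹-involutive w)) (le (w ⁻¹)))
    where
    word⁻¹ : ∀ u → ℓ (eval u ⁻¹) ≤ length u
    word⁻¹ []      = ℕₚ.≤-reflexive (≡.trans (ℓ-cong ε⁻¹≈ε) ℓ-ε)
    word⁻¹ (s ∷ u) = begin
      ℓ ((gen s ∙ eval u) ⁻¹)   ≡⟨ ℓ-cong (solve (⟪ s ⟫ ∷ free (eval u) ∷ [])
                                     (λ s u → ⊖ (s ⊕ u) , ⊖ u ⊕ s) refl) ⟩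
      ℓ (eval u ⁻¹ ∙ gen s)     ≤⟨ ℓ-∙ _ _ ⟩
      ℓ (eval u ⁻¹) + ℓ (gen s) ≤⟨ ℕₚ.+-mono-≤ (word⁻¹ u) (ℓ-gen≤1 s) ⟩
      length u + 1              ≡⟨ ℕₚ.+-comm (length u) 1 ⟩
      suc (length u)            ∎
      where open ℕₚ.≤-Reasoning
    le : ∀ w → ℓ (w ⁻¹) ≤ ℓ w
    le w = ℕₚ.≤-trans (ℓ-≤ (⁻¹-cong (≈-sym (eval-reducedWord w)))) (word⁻¹ (reducedWord w))

  -- Prefixes of reduced words

  open import Data.List.Membership.Setoid setoid using () renaming (_∈_ to _∈ₗ_)

  infix 4 _≼_
  -- The right weak order.
  _≼_ : Carrier → Carrier → Set a
  x ≼ c = ∃[ d ] c ≈ x ∙ d × ℓ c ≡ ℓ x + ℓ d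

  ε≼ : ∀ c → ε ≼ c
  ε≼ c = c , ≈-sym (identityˡ c) , cong (_+ ℓ c) (≡.sym ℓ-ε)

  gen≉ε : ∀ s → ¬ (gen s ≈ ε)
  gen≉ε s eq with ∣⇒≤ (Equivalence.to (gen-order s 1) (≈-trans (identityʳ _) eq))
  ... | s≤s ()

  ℓ-gen : ∀ s → ℓ (gen s) ≡ 1
  ℓ-gen s with ℓ (gen s) in eq | ℓ-gen≤1 s
  ... | zero        | _ = ⊥-elim (gen≉ε s (ℓ≡0⇒≈ε eq))
  ... | suc zero    | _ = refl
  ... | suc (suc _) | s≤s ()

  -- The descent of c at s is absent from x, so it comes from d, where it acts as the reflection t =
  -- x⁻¹ s x. Thus d loses at least the one letter that x gains.
  ≼-step : ∀ s x c → x ≼ c → ℓ x < ℓ (gen s ∙ x) → ℓ (gen s ∙ c) < ℓ c → gen s ∙ x ≼ c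
  ≼-step s x c (d , c≈xd , ℓc) longer shorter = d′ , c≈ , ℕₚ.≤-antisym upper lower
    where
    t  = x ⁻¹ ∙ gen s ∙ x
    d′ = t ∙ d
    c≈ : c ≈ gen s ∙ x ∙ d′
    c≈ = ≈-trans c≈xd (solve (⟪ s ⟫ ∷ free x ∷ free d ∷ [])
      (λ s x d → x ⊕ d , (s ⊕ x) ⊕ (((⊖ x ⊕ s) ⊕ x) ⊕ d)) refl)
    hit-d : Inv d t ≡ true
    hit-d = begin
      Inv d t                      ≡⟨ cong (_xor Inv d t) (longer⇒¬Inv x s longer) ⟨
      Inv x (gen s) xor Inv d t    ≡⟨ Inv-∙ x d (gen s) ⟨
      Inv (x ∙ d) (gen s)          ≡⟨ Inv-cong (gen s) c≈xd ⟨
      Inv c (gen s)                ≡⟨ shorter⇒Inv c s shorter ⟩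
      true                         ∎
      where open ≡.≡-Reasoning
    upper : ℓ c ≤ ℓ (gen s ∙ x) + ℓ d′
    upper = subst (_≤ ℓ (gen s ∙ x) + ℓ d′) (≡.sym (ℓ-cong c≈)) (ℓ-∙ _ _)
    lower : ℓ (gen s ∙ x) + ℓ d′ ≤ ℓ c
    lower = begin
      ℓ (gen s ∙ x) + ℓ d′   ≤⟨ ℕₚ.+-monoˡ-≤ (ℓ d′) (ℓ-gen∙ s x) ⟩
      suc (ℓ x) + ℓ d′       ≡⟨ ℕₚ.+-suc (ℓ x) (ℓ d′) ⟨
      ℓ x + suc (ℓ d′)       ≤⟨ ℕₚ.+-monoʳ-≤ (ℓ x) (Inv⇒shorter d t hit-d) ⟩
      ℓ x + ℓ d              ≡⟨ ℓc ⟨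
      ℓ c                    ∎
      where open ℕₚ.≤-Reasoning

  ℓ-gen∙≢ : ∀ s w → ¬ (ℓ (gen s ∙ w) ≡ ℓ w)
  ℓ-gen∙≢ s w eq with shorter⊎longer s w
  ... | inj₁ shorter = ℕₚ.<⇒≢ shorter eq
  ... | inj₂ longer  = ℕₚ.<⇒≢ longer (≡.sym eq)

  ≯⇒shorter : ∀ s w → ¬ (ℓ w < ℓ (gen s ∙ w)) → ℓ (gen s ∙ w) < ℓ w
  ≯⇒shorter s w ¬longer = ℕₚ.≤∧≢⇒< (ℕₚ.≮⇒≥ ¬longer) (ℓ-gen∙≢ s w)

  ≯⇒longer : ∀ s w → ¬ (ℓ (gen s ∙ w) < ℓ w) → ℓ w < ℓ (gen s ∙ w)
  ≯⇒longer s w ¬shorter = ℕₚ.≤∧≢⇒< (ℕₚ.≮⇒≥ ¬shorter) (λ eq → ℓ-gen∙≢ s w (≡.sym eq))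

  Reduced : List S → Set
  Reduced u = length u ≤ ℓ (eval u)

  reduced-tail : ∀ s u → Reduced (s ∷ u) → Reduced u × ℓ (eval u) < ℓ (gen s ∙ eval u)
  reduced-tail s u red =
    ℕₚ.≤-pred (ℕₚ.≤-trans red (ℓ-gen∙ s (eval u))) ,
    ℕₚ.≤-trans (s≤s (ℓ-minimal u ≈-refl)) red

  reduced-ℓ : ∀ u → Reduced u → ℓ (eval u) ≡ length u
  reduced-ℓ u red = ℕₚ.≤-antisym (ℓ-minimal u ≈-refl) red

  reducedWord-reduced : ∀ w → Reduced (reducedWord w)
  reducedWord-reduced w = ℓ-≤ (≈-sym (eval-reducedWord w))

  ⋆-elim : ∀ {p} (P : Carrier → Set p) s w → (ℓ w < ℓ (gen s ∙ w) → P (gen s ∙ w)) →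
           (ℓ (gen s ∙ w) < ℓ w → P w) → P (s ⋆ w)
  ⋆-elim P s w longer shorter with ℓ w ℕₚ.<? ℓ (gen s ∙ w)
  ... | yes lt = longer lt
  ... | no ¬lt = shorter (≯⇒shorter s w ¬lt)

  foldr-induction : ∀ {p} (P : List S → Carrier → Set p) (_◁_ : S → Carrier → Carrier) {c} →
                    P [] c → (∀ s u w → P u w → P (s ∷ u) (s ◁ w)) → ∀ u → P u (foldr _◁_ c u)
  foldr-induction P _◁_ base step []      = base
  foldr-induction P _◁_ base step (s ∷ u) = step s u _ (foldr-induction P _◁_ base step u)

  -- Where `⋆` multiplies by s, prefix and product gain s together. Where it does nothing, s is
  -- already a descent of the product, and `≼-step` absorbs it into the prefix.
  ⋆-prefix : ∀ c u → Reduced u → eval u ≼ foldr _⋆_ c u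
  ⋆-prefix c = foldr-induction (λ u w → Reduced u → eval u ≼ w) _⋆_ (λ _ → ε≼ c) λ s u w prefix red →
    let redᵘ , longerᵘ = reduced-tail s u red
    in ⋆-elim (gen s ∙ eval u ≼_) s w
         (λ longer → lengthen s u w (prefix redᵘ) longerᵘ longer)
         (λ shorter → ≼-step s (eval u) w (prefix redᵘ) longerᵘ shorter)
    where
    lengthen : ∀ s u w → eval u ≼ w → ℓ (eval u) < ℓ (gen s ∙ eval u) → ℓ w < ℓ (gen s ∙ w) →
               gen s ∙ eval u ≼ gen s ∙ w
    lengthen s u w (d , w≈ , ℓw) longerᵘ longer =
      d , ≈-trans (∙-congˡ w≈) (≈-sym (assoc _ _ _)) , (begin
        ℓ (gen s ∙ w)                 ≡⟨ ℓ-longer s w longer ⟩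
        suc (ℓ w)                     ≡⟨ cong suc ℓw ⟩
        suc (ℓ (eval u)) + ℓ d        ≡⟨ cong (_+ ℓ d) (ℓ-longer s (eval u) longerᵘ) ⟨
        ℓ (gen s ∙ eval u) + ℓ d      ∎)
      where open ≡.≡-Reasoning

  -- Parabolic subgroups and their cosets

  module _ {I : Pred S a} where

    ⟨⟩-resp : ∀ {x y} → x ≈ y → x ∈ ⟨ I ⟩ → y ∈ ⟨ I ⟩
    ⟨⟩-resp x≈y (u , u∈ , ev) = u , u∈ , ≈-trans ev x≈y

    ⟨⟩-ε : ε ∈ ⟨ I ⟩
    ⟨⟩-ε = [] , [] , ≈-refl

    ⟨⟩-gen : ∀ {s} → s ∈ I → gen s ∈ ⟨ I ⟩
    ⟨⟩-gen s∈I = _ ∷ [] , s∈I ∷ [] , identityʳ _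

    ⟨⟩-∙ : ∀ {x y} → x ∈ ⟨ I ⟩ → y ∈ ⟨ I ⟩ → x ∙ y ∈ ⟨ I ⟩
    ⟨⟩-∙ (u , u∈ , ev) (v , v∈ , ev′) =
      u ++ v , Allₚ.++⁺ u∈ v∈ , ≈-trans (eval-++ u v) (∙-cong ev ev′)

    ⟨⟩-⁻¹ : ∀ {x} → x ∈ ⟨ I ⟩ → x ⁻¹ ∈ ⟨ I ⟩
    ⟨⟩-⁻¹ (u , u∈ , ev) = ⟨⟩-resp (⁻¹-cong ev) (go u u∈)
      where
      go : ∀ u → All (_∈ I) u → eval u ⁻¹ ∈ ⟨ I ⟩
      go []      []         = ⟨⟩-resp (≈-sym ε⁻¹≈ε) ⟨⟩-ε
      go (s ∷ u) (s∈ ∷ u∈) = ⟨⟩-resp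
        (solve (⟪ s ⟫ ∷ free (eval u) ∷ []) (λ s u → ⊖ u ⊕ s , ⊖ (s ⊕ u)) refl)
        (⟨⟩-∙ (go u u∈) (⟨⟩-gen s∈))

    private
      -- The exchange condition only deletes letters, so shortening never leaves I: lengths within
      -- W_I agree with lengths in W.
      reduceWord : ∀ u → All (_∈ I) u → ∃[ v ] All (_∈ I) v × eval v ≈ eval u × Reduced v
      reduceWord []      []         = [] , [] , ≈-refl , z≤n
      reduceWord (s ∷ u) (s∈ ∷ u∈) with reduceWord u u∈
      ... | v , v∈ , ev , red with shorter⊎longer s (eval v)
      ...   | inj₂ longer = s ∷ v , s∈ ∷ v∈ , ∙-congˡ ev , ℕₚ.≤-trans (s≤s red) longer
      ...   | inj₁ shorter with exchange v s shorter
      ...     | x , k , y , refl , ev′ =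
        x ++ y , Allₚ.++⁺ (Allₚ.++⁻ˡ x v∈) (All.tail (Allₚ.++⁻ʳ x v∈)) ,
        ≈-trans (≈-sym ev′) (∙-congˡ ev) ,
        ℕₚ.≤-pred (begin
          suc (length (x ++ y))               ≡⟨ length-delete x k y ⟨
          length (x ++ k ∷ y)                 ≤⟨ red ⟩
          ℓ (eval (x ++ k ∷ y))               ≤⟨ ℓ-gen∙′ s _ ⟩
          suc (ℓ (gen s ∙ eval (x ++ k ∷ y))) ≡⟨ cong suc (ℓ-cong ev′) ⟩
          suc (ℓ (eval (x ++ y)))             ∎)
        where open ℕₚ.≤-Reasoning

    reducedIn : ∀ {w} → w ∈ ⟨ I ⟩ → ∃[ u ] All (_∈ I) u × eval u ≈ w × Reduced u
    reducedIn (u , u∈ , ev) = let v , v∈ , ev′ , red = reduceWord u u∈ in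
      v , v∈ , ≈-trans ev′ ev , red

    ℓ≡1⇒gen : ∀ {w} → w ∈ ⟨ I ⟩ → ℓ w ≡ 1 → ∃[ s ] s ∈ I × w ≈ gen s
    ℓ≡1⇒gen {w} w∈ ℓ≡1 = go (reducedIn w∈)
      where
      go : ∃[ u ] All (_∈ I) u × eval u ≈ w × Reduced u → ∃[ s ] s ∈ I × w ≈ gen s
      go ([] , _ , ev , _) = contradiction
        (≡.trans (≡.sym ℓ≡1) (≡.trans (ℓ-cong (≈-sym ev)) ℓ-ε)) λ ()
      go (s ∷ [] , s∈ ∷ _ , ev , _) = s , s∈ , ≈-trans (≈-sym ev) (identityʳ _)
      go (u@(_ ∷ _ ∷ _) , _ , ev , red) = contradiction
        (subst (length u ≤_) (≡.trans (ℓ-cong ev) ℓ≡1) red) λ { (s≤s ()) }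

    gen∈⟨⟩⇒∈ : ∀ {s} → gen s ∈ ⟨ I ⟩ → s ∈ I
    gen∈⟨⟩⇒∈ {s} s∈ = let t , t∈ , eq = ℓ≡1⇒gen s∈ (ℓ-gen s) in
      subst (_∈ I) (≡.sym (gen-injective eq)) t∈

    -- Exchange deletes a letter from a word over I, so s w lies in W_I, and so does s = (s w) w⁻¹.
    descent∈ : ∀ {w} s → w ∈ ⟨ I ⟩ → ℓ (gen s ∙ w) < ℓ w → s ∈ I
    descent∈ {w} s w∈@(u , u∈ , ev) shorter
      with exchange u s (subst₂ _<_ (ℓ-cong (∙-congˡ (≈-sym ev))) (ℓ-cong (≈-sym ev)) shorter)
    ... | x , k , y , refl , ev′ = gen∈⟨⟩⇒∈ (⟨⟩-resp
      (≈-trans (∙-congʳ (≈-trans (≈-sym ev′) (∙-congˡ ev)))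
        (solve (⟪ s ⟫ ∷ free w ∷ []) (λ s w → (s ⊕ w) ⊕ ⊖ w , s) refl))
      (⟨⟩-∙ (x ++ y , Allₚ.++⁺ (Allₚ.++⁻ˡ x u∈) (All.tail (Allₚ.++⁻ʳ x u∈)) , ≈-refl)
            (⟨⟩-⁻¹ w∈)))

    -- The reduced word behind `_*_` is chosen in all of W, so its letters have to be located: each
    -- is a left descent of the part of the word that it begins.
    reduced-letters : ∀ u → Reduced u → eval u ∈ ⟨ I ⟩ → All (_∈ I) u
    reduced-letters []      red u∈ = []
    reduced-letters (s ∷ u) red u∈ with reduced-tail s u red
    ... | red′ , longer = s∈ ∷ reduced-letters u red′
        (⟨⟩-resp (gen-gen s (eval u)) (⟨⟩-∙ (⟨⟩-gen s∈) u∈))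
      where
      s∈ : s ∈ I
      s∈ = descent∈ s u∈ (subst (_< ℓ (gen s ∙ eval u)) (ℓ-cong (≈-sym (gen-gen s (eval u)))) longer)

    ⋆-orbit : ∀ c u → All (_∈ I) u → ∃[ v ] v ∈ ⟨ I ⟩ × foldr _⋆_ c u ≈ v ∙ c
    ⋆-orbit c = foldr-induction (λ u w → All (_∈ I) u → Orbit w) _⋆_
        (λ _ → ε , ⟨⟩-ε , ≈-sym (identityˡ c))
        λ { s u w orbit (s∈ ∷ u∈) → ⋆-elim Orbit s w
          (λ _ → let v , v∈ , w≈ = orbit u∈ in
            gen s ∙ v , ⟨⟩-∙ (⟨⟩-gen s∈) v∈ , ≈-trans (∙-congˡ w≈) (≈-sym (assoc _ _ _)))
          (λ _ → orbit u∈) }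
      where
      Orbit : Carrier → Set a
      Orbit w = ∃[ v ] v ∈ ⟨ I ⟩ × w ≈ v ∙ c

  ⟨⟩-mono : ∀ {I K : Pred S a} → I ⊆ K → ⟨ I ⟩ ⊆ ⟨ K ⟩
  ⟨⟩-mono I⊆K (u , u∈ , ev) = u , All.map I⊆K u∈ , ev

  AllDescents NoDescents : Pred S a → Carrier → Set a
  AllDescents I w = ∀ i → i ∈ I → ℓ (gen i ∙ w) < ℓ w
  NoDescents  I w = ∀ i → i ∈ I → ℓ w < ℓ (gen i ∙ w)

  -- Each letter of a reduced word over I is a descent of c, so `≼-step` absorbs the word from its
  -- right end.
  allDescents⇒≼ : ∀ {I c} → AllDescents I c → ∀ {v} → v ∈ ⟨ I ⟩ → v ≼ c
  allDescents⇒≼ {I} {c} desc v∈ with reducedIn v∈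
  ... | u , u∈ , ev , red = let d , c≈ , ℓc = go u u∈ red in
      d , ≈-trans c≈ (∙-congʳ ev) , ≡.trans ℓc (cong (_+ ℓ d) (ℓ-cong ev))
    where
    go : ∀ u → All (_∈ I) u → Reduced u → eval u ≼ c
    go []      _          _   = ε≼ c
    go (s ∷ u) (s∈ ∷ u∈) red = let red′ , longer = reduced-tail s u red in
      ≼-step s (eval u) c (go u u∈ red′) longer (desc s s∈)

  -- The prefix v⁻¹ of c leaves the cofactor v c. In particular ℓ(c) bounds all lengths in W_I.
  allDescents⇒ℓ : ∀ {I c} → AllDescents I c → ∀ {v} → v ∈ ⟨ I ⟩ → ℓ c ≡ ℓ v + ℓ (v ∙ c)
  allDescents⇒ℓ {I} {c} desc {v} v∈ with allDescents⇒≼ desc (⟨⟩-⁻¹ v∈)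
  ... | d , c≈ , ℓc = ≡.trans ℓc (cong₂ _+_ (ℓ-⁻¹ v) (ℓ-cong
    (≈-trans (solve (free v ∷ free d ∷ []) (λ v d → d , v ⊕ (⊖ v ⊕ d)) refl) (∙-congˡ (≈-sym c≈)))))

  ⟨_⟩∙_ : Pred S a → Carrier → Pred Carrier a
  (⟨ I ⟩∙ z) w = ∃[ v ] v ∈ ⟨ I ⟩ × w ≈ v ∙ z

  private
    -- If a letter failed to lengthen the product, the cocycle rule would move it past `eval u` to a
    -- reflection in W_I that shortens z.
    minimal⇒ℓ : ∀ {I z} → (∀ {v} → v ∈ ⟨ I ⟩ → ℓ z ≤ ℓ (v ∙ z)) →
                ∀ u → All (_∈ I) u → Reduced u → ℓ (eval u ∙ z) ≡ length u + ℓ z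
    minimal⇒ℓ minimal []      _ _ = ℓ-cong (identityˡ _)
    minimal⇒ℓ {I} {z} minimal (s ∷ u) (s∈ ∷ u∈) red with reduced-tail s u red
    ... | red′ , longer with shorter⊎longer s (eval u ∙ z)
    ...   | inj₂ longer′ = ≡.trans (ℓ-cong (assoc _ _ _))
      (≡.trans (ℓ-longer s _ longer′) (cong suc (minimal⇒ℓ minimal u u∈ red′)))
    ...   | inj₁ shorter = contradiction (minimal t∈) (ℕₚ.<⇒≱ (Inv⇒shorter z t hit-z))
      where
      x = eval u
      t = x ⁻¹ ∙ gen s ∙ x
      x∈ : x ∈ ⟨ I ⟩
      x∈ = u , u∈ , ≈-refl
      t∈ : t ∈ ⟨ I ⟩
      t∈ = ⟨⟩-∙ (⟨⟩-∙ (⟨⟩-⁻¹ x∈) (⟨⟩-gen s∈)) x∈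
      hit-z : Inv z t ≡ true
      hit-z = begin
        Inv z t                     ≡⟨ cong (_xor Inv z t) (longer⇒¬Inv x s longer) ⟨
        Inv x (gen s) xor Inv z t   ≡⟨ Inv-∙ x z (gen s) ⟨
        Inv (x ∙ z) (gen s)         ≡⟨ shorter⇒Inv (x ∙ z) s shorter ⟩
        true                        ∎
        where open ≡.≡-Reasoning

    -- Write z = v z₀ with v in W_I. Lengths add over the minimal z₀, so the first letter of a
    -- nonempty reduced word of v would be a left descent of z.
    minimal⇐noDescents : ∀ {I z z₀} → NoDescents I z → z₀ ∈ ⟨ I ⟩∙ z →
                         (∀ {w} → w ∈ ⟨ I ⟩∙ z → ℓ z₀ ≤ ℓ w) → z₀ ≈ z
    minimal⇐noDescents {I} {z} {z₀} none (v₀ , v₀∈ , z₀≈) low = go (reducedIn (⟨⟩-⁻¹ v₀∈))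
      where
      minimal : ∀ {v} → v ∈ ⟨ I ⟩ → ℓ z₀ ≤ ℓ (v ∙ z₀)
      minimal {v} v∈ = low (v ∙ v₀ , ⟨⟩-∙ v∈ v₀∈ , ≈-trans (∙-congˡ z₀≈) (≈-sym (assoc _ _ _)))
      z≈ : z ≈ v₀ ⁻¹ ∙ z₀
      z≈ = ≈-trans (solve (free v₀ ∷ free z ∷ []) (λ v z → z , ⊖ v ⊕ (v ⊕ z)) refl)
                   (∙-congˡ (≈-sym z₀≈))
      go : ∃[ u ] All (_∈ I) u × eval u ≈ v₀ ⁻¹ × Reduced u → z₀ ≈ z
      go ([] , _ , ev , _) = ≈-sym (≈-trans z≈ (≈-trans (∙-congʳ (≈-sym ev)) (identityˡ _)))
      go (s ∷ u , s∈ ∷ u∈ , ev , red) = contradiction (none s s∈) (ℕₚ.<⇒≯ (begin-strict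
          ℓ (gen s ∙ z)             ≡⟨ ℓ-cong (≈-trans (∙-congˡ z≈′) (gen-gen s _)) ⟩
          ℓ (eval u ∙ z₀)           ≡⟨ minimal⇒ℓ minimal u u∈ (proj₁ (reduced-tail s u red)) ⟩
          length u + ℓ z₀           <⟨ ℕₚ.≤-refl ⟩
          length (s ∷ u) + ℓ z₀     ≡⟨ minimal⇒ℓ minimal (s ∷ u) (s∈ ∷ u∈) red ⟨
          ℓ (eval (s ∷ u) ∙ z₀)     ≡⟨ ℓ-cong (≈-trans z≈′ (≈-sym (assoc _ _ _))) ⟨
          ℓ z                       ∎))
        where
        open ℕₚ.≤-Reasoning
        z≈′ : z ≈ gen s ∙ (eval u ∙ z₀)
        z≈′ = ≈-trans z≈ (≈-trans (∙-congʳ (≈-sym ev)) (assoc _ _ _))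

    noDescents⇒minimal : ∀ {I z} → NoDescents I z → ∀ {v} → v ∈ ⟨ I ⟩ → ℓ z ≤ ℓ (v ∙ z)
    noDescents⇒minimal {I} {z} none {v} v∈ =
      let z₀ , z₀∈ , low = argmin (_∈ ⟨ I ⟩∙ z) ℓ (z , ε , ⟨⟩-ε , ≈-sym (identityˡ z))
      in ℕₚ.≤-trans (ℓ-≤ (≈-sym (minimal⇐noDescents none z₀∈ (low _)))) (low _ (v , v∈ , ≈-refl))

  noDescents⇒ℓ : ∀ {I z} → NoDescents I z → ∀ {v} → v ∈ ⟨ I ⟩ → ℓ (v ∙ z) ≡ ℓ v + ℓ z
  noDescents⇒ℓ {I} {z} none {v} v∈ with reducedIn v∈
  ... | u , u∈ , ev , red = begin
    ℓ (v ∙ z)         ≡⟨ ℓ-cong (∙-congʳ ev) ⟨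
    ℓ (eval u ∙ z)    ≡⟨ minimal⇒ℓ (noDescents⇒minimal none) u u∈ red ⟩
    length u + ℓ z    ≡⟨ cong (_+ ℓ z) (reduced-ℓ u red) ⟨
    ℓ (eval u) + ℓ z  ≡⟨ cong (_+ ℓ z) (ℓ-cong ev) ⟩
    ℓ v + ℓ z         ∎
    where open ≡.≡-Reasoning

  -- Lengths in the enlarged group are at most ℓ(c), so its elements are products of boundedly many
  -- letters from a finite supply.
  descents⇒finitary : ∀ {I : Pred S a} {s c} → IsFinitary I →
                      AllDescents (I ∪ ｛ s ｝) c → IsFinitary (I ∪ ｛ s ｝)
  descents⇒finitary {I} {s} {c} (xs , cover) desc = products (ℓ c) , λ w w∈ →
      let u , u∈ , ev , red = reducedIn w∈
      in Membershipₚ.∈-resp-≈ setoid ev (word∈ (ℓ c) u u∈ (begin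
           length u             ≤⟨ red ⟩
           ℓ (eval u)           ≡⟨ ℓ-cong ev ⟩
           ℓ w                  ≤⟨ ℕₚ.m≤m+n (ℓ w) _ ⟩
           ℓ w + ℓ (w ∙ c)      ≡⟨ allDescents⇒ℓ desc w∈ ⟨
           ℓ c                  ∎))
    where
    open ℕₚ.≤-Reasoning
    factors : List Carrier
    -- The enumeration `xs` of W_I contains the letters of I. The factor ε pads shorter words, so
    -- that `products n` covers all lengths up to n.
    factors = ε ∷ gen s ∷ xs
    products : ℕ → List Carrier
    products zero    = ε ∷ []
    products (suc n) = cartesianProductWith _∙_ factors (products n)
    product∈ : ∀ {n x y} → x ∈ₗ factors → y ∈ₗ products n → x ∙ y ∈ₗ products (suc n)
    product∈ = Membershipₚ.∈-cartesianProductWith⁺ setoid setoid setoid ∙-cong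
    letter∈ : ∀ {k} → k ∈ I ∪ ｛ s ｝ → gen k ∈ₗ factors
    letter∈ (inj₁ k∈I)  = there (there (cover _ (⟨⟩-gen k∈I)))
    letter∈ (inj₂ refl) = there (here ≈-refl)
    word∈ : ∀ n u → All (_∈ I ∪ ｛ s ｝) u → length u ≤ n → eval u ∈ₗ products n
    word∈ zero    []      _          _        = here ≈-refl
    word∈ (suc n) []      _          _        = Membershipₚ.∈-resp-≈ setoid (identityˡ _)
      (product∈ {n} (here ≈-refl) (word∈ n [] [] z≤n))
    word∈ (suc n) (k ∷ u) (k∈ ∷ u∈) (s≤s le) = product∈ {n} (letter∈ k∈) (word∈ n u u∈ le)

  -- Longest elements of finitary subsets

  module _ (I : Finitary) where

    w₀∈ : w₀ I ∈ ⟨ set I ⟩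
    w₀∈ = proj₁ (proj₂ (longest I))

    w₀-longest : ∀ {v} → v ∈ ⟨ set I ⟩ → ℓ v ≤ ℓ₀ I
    w₀-longest {v} = proj₂ (proj₂ (longest I)) v

    w₀-descents : AllDescents (set I) (w₀ I)
    w₀-descents i i∈ = ≯⇒shorter i (w₀ I) λ longer →
      ℕₚ.<⇒≱ longer (w₀-longest (⟨⟩-∙ (⟨⟩-gen i∈) w₀∈))

    ℓ-w₀ : ∀ {v} → v ∈ ⟨ set I ⟩ → ℓ₀ I ≡ ℓ v + ℓ (v ∙ w₀ I)
    ℓ-w₀ = allDescents⇒ℓ w₀-descents

    w₀-unique : ∀ {v} → v ∈ ⟨ set I ⟩ → ℓ₀ I ≤ ℓ v → v ≈ w₀ I
    w₀-unique {v} v∈ ℓ₀≤ = go (allDescents⇒≼ w₀-descents v∈)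
      where
      go : v ≼ w₀ I → v ≈ w₀ I
      go (d , w₀≈ , ℓ₀≡) = ≈-sym (≈-trans w₀≈ (≈-trans (∙-congˡ (ℓ≡0⇒≈ε ℓd≡0)) (identityʳ v)))
        where
        ℓd≡0 : ℓ d ≡ 0
        ℓd≡0 = ℕₚ.n≤0⇒n≡0 (ℕₚ.+-cancelˡ-≤ (ℓ v) (ℓ d) 0
          (subst₂ _≤_ ℓ₀≡ (≡.sym (ℕₚ.+-identityʳ (ℓ v))) ℓ₀≤))

    w₀⁻¹ : w₀ I ⁻¹ ≈ w₀ I
    w₀⁻¹ = w₀-unique (⟨⟩-⁻¹ w₀∈) (ℕₚ.≤-reflexive (≡.sym (ℓ-⁻¹ (w₀ I))))

    w₀² : w₀ I ∙ w₀ I ≈ ε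
    w₀² = ≈-trans (∙-congˡ (≈-sym w₀⁻¹)) (inverseʳ _)

    ⟪w₀⟫ : Atom
    ⟪w₀⟫ = involution (w₀ I) w₀²

    ℓ-w₀ʳ : ∀ {v} → v ∈ ⟨ set I ⟩ → ℓ₀ I ≡ ℓ v + ℓ (w₀ I ∙ v)
    ℓ-w₀ʳ {v} v∈ = ≡.trans (ℓ-w₀ (⟨⟩-⁻¹ v∈)) (cong₂ _+_ (ℓ-⁻¹ v)
      (≡.trans (≡.sym (ℓ-⁻¹ _)) (ℓ-cong (solve (⟪w₀⟫ ∷ free v ∷ [])
        (λ w v → ⊖ (⊖ v ⊕ w) , w ⊕ v) refl))))

    -- Multiplication by w_I on either side replaces a length in W_I by its complement in ℓ(I);
    -- doing so on both sides restores it.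
    ℓ-w₀-conj : ∀ {v} → v ∈ ⟨ set I ⟩ → ℓ (w₀ I ∙ v ∙ w₀ I) ≡ ℓ v
    ℓ-w₀-conj {v} v∈ = ℕₚ.+-cancelˡ-≡ (ℓ (w₀ I ∙ v)) _ _ (begin
      ℓ (w₀ I ∙ v) + ℓ (w₀ I ∙ v ∙ w₀ I)   ≡⟨ ℓ-w₀ (⟨⟩-∙ w₀∈ v∈) ⟨
      ℓ₀ I                                 ≡⟨ ℓ-w₀ʳ v∈ ⟩
      ℓ v + ℓ (w₀ I ∙ v)                   ≡⟨ ℕₚ.+-comm (ℓ v) _ ⟩
      ℓ (w₀ I ∙ v) + ℓ v                   ∎)
      where open ≡.≡-Reasoning

    w₀-conj-gen : ∀ {s} → s ∈ set I → ∃[ t ] t ∈ set I × w₀ I ∙ gen s ∙ w₀ I ≈ gen t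
    w₀-conj-gen {s} s∈ = ℓ≡1⇒gen (⟨⟩-∙ (⟨⟩-∙ w₀∈ (⟨⟩-gen s∈)) w₀∈)
      (≡.trans (ℓ-w₀-conj (⟨⟩-gen s∈)) (ℓ-gen s))

  ℓ₀-mono : ∀ {I K : Finitary} → set I ⊆ set K → ℓ₀ I ≤ ℓ₀ K
  ℓ₀-mono {I} {K} I⊆K = w₀-longest K (⟨⟩-mono I⊆K (w₀∈ I))

  ℓ₀-strict : ∀ {I K : Finitary} {s} → set I ⊆ set K → s ∈ set K → s ∉ set I → ℓ₀ I < ℓ₀ K
  ℓ₀-strict {I} {K} {s} I⊆K s∈K s∉I = ℕₚ.<-≤-trans
    (≯⇒longer s (w₀ I) λ shorter → s∉I (descent∈ s (w₀∈ I) shorter))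
    (w₀-longest K (⟨⟩-∙ (⟨⟩-gen s∈K) (⟨⟩-mono I⊆K (w₀∈ I))))

  noDescents-unique : ∀ {I z z′} → NoDescents I z → NoDescents I z′ → z′ ∈ ⟨ I ⟩∙ z → z′ ≈ z
  noDescents-unique {I} {z} {z′} none none′ (u , u∈ , eq) =
    ≈-trans eq (≈-trans (∙-congʳ (ℓ≡0⇒≈ε ℓu≡0)) (identityˡ z))
    where
    ℓu≡0 : ℓ u ≡ 0
    ℓu≡0 = ℕₚ.n≤0⇒n≡0 (ℕₚ.+-cancelʳ-≤ (ℓ z) (ℓ u) 0 (begin
      ℓ u + ℓ z           ≡⟨ noDescents⇒ℓ none u∈ ⟨
      ℓ (u ∙ z)           ≡⟨ ℓ-cong eq ⟨
      ℓ z′                ≤⟨ ℕₚ.m≤n+m _ (ℓ (u ⁻¹)) ⟩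
      ℓ (u ⁻¹) + ℓ z′     ≡⟨ noDescents⇒ℓ none′ (⟨⟩-⁻¹ u∈) ⟨
      ℓ (u ⁻¹ ∙ z′)       ≡⟨ ℓ-cong (≈-trans (∙-congˡ eq) (solve (free u ∷ free z ∷ [])
                               (λ u z → ⊖ u ⊕ (u ⊕ z) , z) refl)) ⟩
      ℓ z                 ∎))
      where open ℕₚ.≤-Reasoning

  -- Multiplication by w_I takes ℓ(I) off c = u z, yet the result is still at least as long as z. So
  -- ℓ(u) is at least ℓ(I).
  allDescents-unique : ∀ {z c} (I : Finitary) → NoDescents (set I) z → AllDescents (set I) c →
                       c ∈ ⟨ set I ⟩∙ z → c ≈ w₀ I ∙ z
  allDescents-unique {z} {c} I none all (u , u∈ , eq) = ≈-trans eq (∙-congʳ (w₀-unique I u∈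
    (ℕₚ.+-cancelʳ-≤ (ℓ z) _ _ (begin
      ℓ₀ I + ℓ z                       ≤⟨ ℕₚ.+-monoʳ-≤ (ℓ₀ I) (ℕₚ.m≤n+m (ℓ z) (ℓ (w₀ I ∙ u))) ⟩
      ℓ₀ I + (ℓ (w₀ I ∙ u) + ℓ z)      ≡⟨ cong (λ n → ℓ₀ I + n) (noDescents⇒ℓ none (⟨⟩-∙ (w₀∈ I) u∈)) ⟨
      ℓ₀ I + ℓ (w₀ I ∙ u ∙ z)          ≡⟨ cong (λ n → ℓ₀ I + n) (ℓ-cong (≈-trans (∙-congˡ eq) (≈-sym (assoc _ _ _)))) ⟨
      ℓ₀ I + ℓ (w₀ I ∙ c)              ≡⟨ allDescents⇒ℓ all (w₀∈ I) ⟨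
      ℓ c                              ≡⟨ ℓ-cong eq ⟩
      ℓ (u ∙ z)                        ≡⟨ noDescents⇒ℓ none u∈ ⟩
      ℓ u + ℓ z                        ∎))))
    where open ℕₚ.≤-Reasoning

  -- Core cosets

  infix 4 _≐[_]_
  -- The relation in `Core` for an arbitrary conjugator in place of the minimal element, so that
  -- such relations can be inverted and composed.
  _≐[_]_ : Pred S a → Carrier → Pred S a → Set a
  I ≐[ z ] J = gens I ≐ conjugate z (gens J)

  ≐[]-cong : ∀ {I J z z′} → z ≈ z′ → I ≐[ z ] J → I ≐[ z′ ] J
  ≐[]-cong z≈ (to , from) =
    (λ w∈ → let y , y∈ , eq = to w∈ in
      y , y∈ , ≈-trans eq (∙-cong (∙-congʳ z≈) (⁻¹-cong z≈))) ,
    (λ (y , y∈ , eq) → from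
      (y , y∈ , ≈-trans eq (∙-cong (∙-congʳ (≈-sym z≈)) (⁻¹-cong (≈-sym z≈)))))

  ≐[]-sym : ∀ {I J z} → I ≐[ z ] J → J ≐[ z ⁻¹ ] I
  ≐[]-sym {I} {J} {z} (to , from) =
    (λ {w} w∈ → z ∙ w ∙ z ⁻¹ , from (w , w∈ , ≈-refl) ,
      solve (free z ∷ free w ∷ []) (λ z w → w , (⊖ z ⊕ ((z ⊕ w) ⊕ ⊖ z)) ⊕ ⊖ ⊖ z) refl) ,
    λ {w} (y , y∈ , w≈) → let x , (k , k∈ , x≈) , y≈ = to y∈ in
      k , k∈ , ≈-trans w≈ (≈-trans (∙-congʳ (∙-congˡ y≈)) (≈-trans
        (solve (free z ∷ free x ∷ []) (λ z x → (⊖ z ⊕ ((z ⊕ x) ⊕ ⊖ z)) ⊕ ⊖ ⊖ z , x) refl) x≈))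

  ≐[]-trans : ∀ {I J K y z} → I ≐[ y ] J → J ≐[ z ] K → I ≐[ y ∙ z ] K
  ≐[]-trans {I} {J} {K} {y} {z} (to , from) (to′ , from′) =
    (λ w∈ → let j , j∈ , w≈ = to w∈ ; k , k∈ , j≈ = to′ j∈ in
      k , k∈ , ≈-trans w≈ (≈-trans (∙-congʳ (∙-congˡ j≈)) (solve (free y ∷ free z ∷ free k ∷ [])
        (λ y z k → (y ⊕ ((z ⊕ k) ⊕ ⊖ z)) ⊕ ⊖ y , ((y ⊕ z) ⊕ k) ⊕ ⊖ (y ⊕ z)) refl))) ,
    λ (k , k∈ , w≈) → from (z ∙ k ∙ z ⁻¹ , from′ (k , k∈ , ≈-refl) ,
      ≈-trans w≈ (solve (free y ∷ free z ∷ free k ∷ [])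
        (λ y z k → ((y ⊕ z) ⊕ k) ⊕ ⊖ (y ⊕ z) , (y ⊕ ((z ⊕ k) ⊕ ⊖ z)) ⊕ ⊖ y) refl))

  w₀-≐[] : ∀ I → set I ≐[ w₀ I ] set I
  w₀-≐[] I =
    (λ {w} (s , s∈ , w≈) → let t , t∈ , eq = w₀-conj-gen I s∈ in
      gen t , (t , t∈ , ≈-refl) ,
      ≈-trans w≈ (≈-trans (solve (⟪w₀⟫ I ∷ ⟪ s ⟫ ∷ []) (λ w s → s , (w ⊕ ((w ⊕ s) ⊕ w)) ⊕ ⊖ w) refl)
        (∙-congʳ (∙-congˡ eq)))) ,
    λ (y , (s , s∈ , y≈) , w≈) → let t , t∈ , eq = w₀-conj-gen I s∈ in
      t , t∈ , ≈-trans w≈ (≈-trans (∙-cong (∙-congˡ y≈) (w₀⁻¹ I)) eq)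

  -- Every letter of I passes z as one letter of J. The equality of word lengths serves to bound the
  -- length of the conjugated element.
  slide : ∀ {I J z} → I ≐[ z ] J → ∀ u → All (_∈ I) u →
          ∃[ v ] All (_∈ J) v × length v ≡ length u × eval u ∙ z ≈ z ∙ eval v
  slide I≐J []      []         = [] , [] , refl , ≈-trans (identityˡ _) (≈-sym (identityʳ _))
  slide {I} {J} {z} I≐J (s ∷ u) (s∈ ∷ u∈) =
    let v , v∈ , len , eq = slide I≐J u u∈
        y , (t , t∈ , y≈) , s≈ = proj₁ I≐J (s , s∈ , ≈-refl)
    in t ∷ v , t∈ ∷ v∈ , cong suc len ,
       (begin
          gen s ∙ eval u ∙ z                 ≈⟨ assoc _ _ _ ⟩
          gen s ∙ (eval u ∙ z)               ≈⟨ ∙-cong s≈ eq ⟩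
          z ∙ y ∙ z ⁻¹ ∙ (z ∙ eval v)        ≈⟨ solve (free z ∷ free y ∷ free (eval v) ∷ [])
                                                  (λ z y v → ((z ⊕ y) ⊕ ⊖ z) ⊕ (z ⊕ v) , z ⊕ (y ⊕ v)) refl ⟩
          z ∙ (y ∙ eval v)                   ≈⟨ ∙-congˡ (∙-congʳ y≈) ⟩
          z ∙ (gen t ∙ eval v)               ∎)
    where open ≈-Reasoning

  slideʳ : ∀ {I J z} → I ≐[ z ] J → ∀ {v} → v ∈ ⟨ J ⟩ → ∃[ u ] u ∈ ⟨ I ⟩ × z ∙ v ≈ u ∙ z
  slideʳ {I} {J} {z} I≐J {v} (w , w∈ , ev) =
    let w′ , w′∈ , _ , eq = slide (≐[]-sym I≐J) w w∈ in
    eval w′ , (w′ , w′∈ , ≈-refl) , (begin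
      z ∙ v                        ≈⟨ ∙-congˡ ev ⟨
      z ∙ eval w                   ≈⟨ solve (free z ∷ free (eval w) ∷ [])
                                        (λ z w → z ⊕ w , z ⊕ ((w ⊕ ⊖ z) ⊕ z)) refl ⟩
      z ∙ (eval w ∙ z ⁻¹ ∙ z)      ≈⟨ ∙-congˡ (∙-congʳ eq) ⟩
      z ∙ (z ⁻¹ ∙ eval w′ ∙ z)     ≈⟨ solve (free z ∷ free (eval w′) ∷ [])
                                        (λ z w → z ⊕ ((⊖ z ⊕ w) ⊕ z) , w ⊕ z) refl ⟩
      eval w′ ∙ z                  ∎)
    where open ≈-Reasoning

  module _ {I J : Finitary} (p : Coset I J) where

    ⟦⟧-∙ˡ : ∀ {v w} → v ∈ ⟨ set I ⟩ → w ∈ ⟦ p ⟧ → v ∙ w ∈ ⟦ p ⟧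
    ⟦⟧-∙ˡ {v} v∈ (x , y , x∈ , y∈ , w≈) = v ∙ x , y , ⟨⟩-∙ v∈ x∈ , y∈ ,
      ≈-trans (∙-congˡ w≈) (solve (free v ∷ free x ∷ free (rep p) ∷ free y ∷ [])
        (λ v x r y → v ⊕ ((x ⊕ r) ⊕ y) , ((v ⊕ x) ⊕ r) ⊕ y) refl)

    rep∈ : rep p ∈ ⟦ p ⟧
    rep∈ = ε , ε , ⟨⟩-ε , ⟨⟩-ε , solve (free (rep p) ∷ []) (λ r → r , (id ⊕ r) ⊕ id) refl

    -- The Bruhat relation multiplies by reflections on the right, so s w has to be read as w (w⁻¹ s
    -- w).
    longer⇒<ᴮ : ∀ s w → ℓ w < ℓ (gen s ∙ w) → w <ᴮ gen s ∙ w
    longer⇒<ᴮ s w lt = [ (_ , (w ⁻¹ , s , ≈-refl) ,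
      solve (⟪ s ⟫ ∷ free w ∷ []) (λ s w → s ⊕ w , w ⊕ ((⊖ w ⊕ s) ⊕ ⊖ ⊖ w)) refl) , lt ]

    shorter⇒<ᴮ : ∀ s w → ℓ (gen s ∙ w) < ℓ w → gen s ∙ w <ᴮ w
    shorter⇒<ᴮ s w lt = [ (_ , ((gen s ∙ w) ⁻¹ , s , ≈-refl) ,
      solve (⟪ s ⟫ ∷ free w ∷ [])
        (λ s w → w , (s ⊕ w) ⊕ ((⊖ (s ⊕ w) ⊕ s) ⊕ ⊖ ⊖ (s ⊕ w))) refl) , lt ]

    min∈ : min p ∈ ⟦ p ⟧
    min∈ = proj₁ (proj₂ (bruhatMin p))

    max∈ : max p ∈ ⟦ p ⟧
    max∈ = proj₁ (proj₂ (bruhatMax p))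

    min-noDescents : NoDescents (set I) (min p)
    min-noDescents i i∈ = ≯⇒longer i (min p) λ shorter →
      proj₂ (proj₂ (bruhatMin p)) _ (⟦⟧-∙ˡ (⟨⟩-gen i∈) min∈) (shorter⇒<ᴮ i (min p) shorter)

    max-allDescents : AllDescents (set I) (max p)
    max-allDescents i i∈ = ≯⇒shorter i (max p) λ longer →
      proj₂ (proj₂ (bruhatMax p)) _ (⟦⟧-∙ˡ (⟨⟩-gen i∈) max∈) (longer⇒<ᴮ i (max p) longer)

    ∈⟦⟧⇒≈ᶜ : ∀ {w} → w ∈ ⟦ p ⟧ → p ≈ᶜ W[ w ]W
    ∈⟦⟧⇒≈ᶜ {w} (x , y , x∈ , y∈ , w≈) =
      (λ {w′} (x′ , y′ , x′∈ , y′∈ , w′≈) → x′ ∙ x ⁻¹ , y ⁻¹ ∙ y′ ,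
        ⟨⟩-∙ x′∈ (⟨⟩-⁻¹ x∈) , ⟨⟩-∙ (⟨⟩-⁻¹ y∈) y′∈ ,
        ≈-trans w′≈ (≈-trans
          (solve (free x ∷ free y ∷ free x′ ∷ free y′ ∷ free (rep p) ∷ [])
            (λ x y x′ y′ r → (x′ ⊕ r) ⊕ y′ , ((x′ ⊕ ⊖ x) ⊕ ((x ⊕ r) ⊕ y)) ⊕ (⊖ y ⊕ y′)) refl)
          (∙-congʳ (∙-congˡ (≈-sym w≈))))) ,
      λ {w′} (x′ , y′ , x′∈ , y′∈ , w′≈) → x′ ∙ x , y ∙ y′ , ⟨⟩-∙ x′∈ x∈ , ⟨⟩-∙ y∈ y′∈ ,
        ≈-trans w′≈ (≈-trans (∙-congʳ (∙-congˡ w≈))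
          (solve (free x ∷ free y ∷ free x′ ∷ free y′ ∷ free (rep p) ∷ [])
            (λ x y x′ y′ r → (x′ ⊕ ((x ⊕ r) ⊕ y)) ⊕ y′ , ((x′ ⊕ x) ⊕ r) ⊕ (y ⊕ y′)) refl))

    -- `min p` is known only as a chosen minimiser; an explicit candidate z is studied first and
    -- identified with it in `min≈`.
    module CoreCoset {z} (z∈ : z ∈ ⟦ p ⟧) (I≐J : set I ≐[ z ] set J) where

      coset⊆ : ⟦ p ⟧ ⊆ ⟨ set I ⟩∙ z
      coset⊆ w∈ =
        let x , y , x∈ , y∈ , w≈ = proj₁ (∈⟦⟧⇒≈ᶜ z∈) w∈
            u , u∈ , eq          = slideʳ I≐J y∈
        in x ∙ u , ⟨⟩-∙ x∈ u∈ , ≈-trans w≈ (≈-trans (assoc _ _ _)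
             (≈-trans (∙-congˡ eq) (≈-sym (assoc _ _ _))))

      module _ (none : NoDescents (set I) z) where

        min≈ : min p ≈ z
        min≈ = noDescents-unique none min-noDescents (coset⊆ min∈)

        max≈ : max p ≈ w₀ I ∙ z
        max≈ = allDescents-unique I none max-allDescents (coset⊆ max∈)

        max-longest : ∀ {w} → w ∈ ⟦ p ⟧ → ℓ w ≤ ℓ (max p)
        max-longest {w} w∈ = let u , u∈ , eq = coset⊆ w∈ in begin
          ℓ w              ≡⟨ ℓ-cong eq ⟩
          ℓ (u ∙ z)        ≡⟨ noDescents⇒ℓ none u∈ ⟩
          ℓ u + ℓ z        ≤⟨ ℕₚ.+-monoˡ-≤ (ℓ z) (w₀-longest I u∈) ⟩
          ℓ₀ I + ℓ z       ≡⟨ noDescents⇒ℓ none (w₀∈ I) ⟨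
          ℓ (w₀ I ∙ z)     ≡⟨ ℓ-cong max≈ ⟨
          ℓ (max p)        ∎
          where open ℕₚ.≤-Reasoning

  -- Reduced expressions

  tailValue : List (Finitary × Finitary) → Carrier
  tailValue = foldr (λ (I , K) x → w₀ I ⁻¹ ∙ w₀ K ∙ x) ε

  -- The truncated subtraction is exact on `Growing` pairs, and there it is positive: zero gain
  -- means that no addition follows a removal.
  gain : List (Finitary × Finitary) → ℕ
  gain = foldr (λ (I , K) n → (ℓ₀ K ∸ ℓ₀ I) + n) 0

  total : Grouping → ℕ
  total (K , rest) = ℓ₀ K + gain rest

  Growing : Pred (Finitary × Finitary) a
  Growing (I , K) = set I ⊆ set K × ∃[ s ] s ∈ set K × s ∉ set I

  growing⇒< : ∀ {I K} → Growing (I , K) → ℓ₀ I < ℓ₀ K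
  growing⇒< {I} {K} (I⊆K , s , s∈K , s∉I) = ℓ₀-strict {I} {K} I⊆K s∈K s∉I

  ascend-⊇ : ∀ {I J} (e : Expression I J) → set I ⊆ set (proj₁ (ascend e))
  ascend-⊇ (stop _)          i∈ = i∈
  ascend-⊇ (add s _ K≐ e)    i∈ = ascend-⊇ e (proj₂ K≐ (inj₁ i∈))
  ascend-⊇ (remove _ _ _ _)  i∈ = i∈

  add-growing : ∀ I {K J s} → s ∉ set I → set K ≐ set I ∪ ｛ s ｝ → (e : Expression K J) →
                Growing (I , proj₁ (ascend e))
  add-growing I s∉I K≐ e =
    (λ i∈ → ascend-⊇ e (proj₂ K≐ (inj₁ i∈))) , _ , ascend-⊇ e (proj₂ K≐ (inj₂ refl)) , s∉I

  ascend-growing  : ∀ {I J} (e : Expression I J) → All Growing (proj₂ (ascend e))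
  descend-growing : ∀ {I J} (e : Expression I J) → All Growing (descend e)
  ascend-growing  (stop _)         = []
  ascend-growing  (add _ _ _ e)    = ascend-growing e
  ascend-growing  (remove _ _ _ e) = descend-growing e
  descend-growing (stop _)         = []
  descend-growing {I} (add s s∉I K≐ e) = add-growing I s∉I K≐ e ∷ ascend-growing e
  descend-growing (remove _ _ _ e) = descend-growing e

  private
    -i+k≡k∸i : ∀ {i k} → i ≤ k → ℤ.- (+ i) ℤ.+ + k ≡ + (k ∸ i)
    -i+k≡k∸i {i} {k} i≤k = ≡.trans (ℤₚ.+-comm (ℤ.- (+ i)) (+ k))
      (≡.trans (ℤₚ.m-n≡m⊖n k i) (ℤₚ.⊖-≥ i≤k))

    alternating≡gain : ∀ {rest} → All Growing rest →
      foldr (λ (I , K) n → ℤ.- (+ ℓ₀ I) ℤ.+ + ℓ₀ K ℤ.+ n) (+ 0) rest ≡ + gain rest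
    alternating≡gain []                          = refl
    alternating≡gain {(I , K) ∷ rest} (g ∷ gs) =
      cong₂ ℤ._+_ (-i+k≡k∸i (ℕₚ.<⇒≤ (growing⇒< {I} {K} g))) (alternating≡gain gs)

  alternatingLength≡total : ∀ {I J} (e : Expression I J) →
                            alternatingLength (group e) ≡ + total (group e)
  alternatingLength≡total e =
    cong (λ n → + ℓ₀ (proj₁ (group e)) ℤ.+ n) (alternating≡gain (ascend-growing e))

  ℓ-tailValue : ∀ {rest} → All Growing rest → ℓ (tailValue rest) ≤ gain rest
  ℓ-tailValue []                              = ℕₚ.≤-reflexive ℓ-ε
  ℓ-tailValue {(I , K) ∷ rest} ((I⊆K , _) ∷ gs) = ℕₚ.≤-trans (ℓ-∙ _ _)
    (ℕₚ.+-mono-≤ (ℕₚ.≤-reflexive ℓ-quotient) (ℓ-tailValue gs))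
    where
    ℓ-quotient : ℓ (w₀ I ⁻¹ ∙ w₀ K) ≡ ℓ₀ K ∸ ℓ₀ I
    ℓ-quotient = ≡.sym (≡.trans
      (cong (_∸ ℓ₀ I) (≡.trans (ℓ-w₀ K (⟨⟩-mono I⊆K (⟨⟩-⁻¹ (w₀∈ I))))
        (cong (_+ ℓ (w₀ I ⁻¹ ∙ w₀ K)) (ℓ-⁻¹ (w₀ I)))))
      (ℕₚ.m+n∸m≡n (ℓ₀ I) _))

  private
    w₀-descentʳ : ∀ {K j} → j ∈ set K → suc (ℓ (w₀ K ∙ ε ∙ gen j)) ≡ ℓ₀ K
    w₀-descentʳ {K} {j} j∈ = begin
      suc (ℓ (w₀ K ∙ ε ∙ gen j))       ≡⟨ cong suc (ℓ-cong (∙-congʳ (identityʳ _))) ⟩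
      suc (ℓ (w₀ K ∙ gen j))           ≡⟨ cong (_+ ℓ (w₀ K ∙ gen j)) (ℓ-gen j) ⟨
      ℓ (gen j) + ℓ (w₀ K ∙ gen j)     ≡⟨ ℓ-w₀ʳ K (⟨⟩-gen j∈) ⟨
      ℓ₀ K                             ∎
      where open ≡.≡-Reasoning

  -- An expression ending in J has right descents J as soon as it is reduced.
  ascend-descentʳ : ∀ {I J j} (e : Expression I J) → j ∈ set J →
                    ℓ (value (ascend e) ∙ gen j) < total (ascend e)
  descend-descentʳ : ∀ {I J j} (e : Expression I J) → j ∈ set J → ∀ K → set I ⊆ set K →
                     ℓ (w₀ K ∙ tailValue (descend e) ∙ gen j) < ℓ₀ K + gain (descend e)
  ascend-descentʳ {I} (stop I≐J) j∈ = ℕₚ.≤-reflexive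
    (≡.trans (w₀-descentʳ {I} (proj₂ I≐J j∈)) (≡.sym (ℕₚ.+-identityʳ _)))
  ascend-descentʳ (add _ _ _ e) j∈ = ascend-descentʳ e j∈
  -- The run of additions ends here: the current set becomes the peak that `descend-descentʳ`
  -- carries along while removals shrink the set below it.
  ascend-descentʳ {I} (remove t _ K≐ e) j∈ =
    descend-descentʳ e j∈ I (λ k∈ → proj₁ (proj₁ K≐ k∈))
  descend-descentʳ (stop I≐J) j∈ K I⊆K = ℕₚ.≤-reflexive
    (≡.trans (w₀-descentʳ {K} (I⊆K (proj₂ I≐J j∈))) (≡.sym (ℕₚ.+-identityʳ _)))
  descend-descentʳ (remove _ _ K≐ e) j∈ K I⊆K =
    descend-descentʳ e j∈ K (λ k∈ → I⊆K (proj₁ (proj₁ K≐ k∈)))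
  descend-descentʳ {I} {j = j} (add s s∉I K≐ e) j∈ K I⊆K = begin
    suc (ℓ (w₀ K ∙ (w₀ I ⁻¹ ∙ w₀ K′ ∙ x) ∙ gen j))
      ≡⟨ cong suc (ℓ-cong (solve (free (w₀ K) ∷ free (w₀ I) ∷ free (w₀ K′) ∷ free x ∷ ⟪ j ⟫ ∷ [])
           (λ k i k′ x j → (k ⊕ ((⊖ i ⊕ k′) ⊕ x)) ⊕ j , (k ⊕ ⊖ i) ⊕ ((k′ ⊕ x) ⊕ j)) refl)) ⟩
    -- The factor w_K w_I⁻¹ has length q = ℓ(K) - ℓ(I); the unit is lost in the part from the next
    -- peak `K′` on.
    suc (ℓ (w₀ K ∙ w₀ I ⁻¹ ∙ (w₀ K′ ∙ x ∙ gen j)))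
      ≤⟨ s≤s (ℓ-∙ _ _) ⟩
    suc (q + ℓ (w₀ K′ ∙ x ∙ gen j))
      ≡⟨ ℕₚ.+-suc q _ ⟨
    q + suc (ℓ (w₀ K′ ∙ x ∙ gen j))
      ≤⟨ ℕₚ.+-monoʳ-≤ q (ascend-descentʳ e j∈) ⟩
    q + (ℓ₀ K′ + g)
      ≡⟨ cong (λ n → q + (n + g)) (ℕₚ.m+[n∸m]≡n (ℕₚ.<⇒≤ (growing⇒< {I} {K′} (add-growing I s∉I K≐ e)))) ⟨
    q + (ℓ₀ I + (ℓ₀ K′ ∸ ℓ₀ I) + g)
      ≡⟨ ℕSolver.+-*-Solver.solve 4 (λ q i d g → q :+ (i :+ d :+ g) := i :+ q :+ (d :+ g)) refl
           q (ℓ₀ I) (ℓ₀ K′ ∸ ℓ₀ I) g ⟩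
    ℓ₀ I + q + (ℓ₀ K′ ∸ ℓ₀ I + g)
      ≡⟨ cong (λ n → n + q + (ℓ₀ K′ ∸ ℓ₀ I + g)) (ℓ-⁻¹ (w₀ I)) ⟨
    ℓ (w₀ I ⁻¹) + q + (ℓ₀ K′ ∸ ℓ₀ I + g)
      ≡⟨ cong (_+ (ℓ₀ K′ ∸ ℓ₀ I + g)) (ℓ-w₀ʳ K (⟨⟩-mono I⊆K (⟨⟩-⁻¹ (w₀∈ I)))) ⟨
    ℓ₀ K + (ℓ₀ K′ ∸ ℓ₀ I + g) ∎
    where
    open ℕₚ.≤-Reasoning
    open ℕSolver.+-*-Solver using (_:+_; _:=_)
    K′ = proj₁ (ascend e)
    x  = tailValue (proj₂ (ascend e))
    g  = gain (proj₂ (ascend e))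
    q  = ℓ (w₀ K ∙ w₀ I ⁻¹)

  reduced⇒total : ∀ {I J} {p : Coset I J} (e : Expression I J) → ReducedExpression p e →
                  ℓ (max p) ≡ total (group e)
  reduced⇒total e (_ , len) = ℤₚ.+-injective (≡.trans len (alternatingLength≡total e))

  add-gain≢0 : ∀ I {K J s} (s∉I : s ∉ set I) (K≐ : set K ≐ set I ∪ ｛ s ｝) (e : Expression K J) →
               ¬ (gain (descend (add {I} {K} {J} s s∉I K≐ e)) ≡ 0)
  add-gain≢0 I s∉I K≐ e g≡0 = ℕₚ.m<n⇒n≢0
    (ℕₚ.m<n⇒0<n∸m (growing⇒< {I} {proj₁ (ascend e)} (add-growing I s∉I K≐ e))) (ℕₚ.m+n≡0⇒m≡0 _ g≡0)

  gain≡0⇒⊇ : ∀ {I J} (e : Expression I J) → gain (descend e) ≡ 0 → set J ⊆ set I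
  gain≡0⇒⊇ (stop I≐J)       _  j∈ = proj₂ I≐J j∈
  gain≡0⇒⊇ (remove _ _ K≐ e) g≡0 j∈ = proj₁ (proj₁ K≐ (gain≡0⇒⊇ e g≡0 j∈))
  gain≡0⇒⊇ {I} (add _ s∉I K≐ e) g≡0 = ⊥-elim (add-gain≢0 I s∉I K≐ e g≡0)

  -- A total of ℓ(I) affords no rise, and a removed element could return only by a rise.
  identity-unique : ∀ {I J} (e : Expression I J) → set I ≐ set J → total (group e) ≡ ℓ₀ I →
                    Pointwise (λ K L → set K ≐ set L) (terms e) (I ∷ [])
  identity-unique (stop _) _ _ = ≐-refl ∷ []
  identity-unique {I} (add s s∉I K≐ e) _ total≡ = contradiction
    (ℕₚ.≤-trans (growing⇒< {I} {proj₁ (ascend e)} (add-growing I s∉I K≐ e)) (ℕₚ.m≤m+n _ _))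
    (ℕₚ.<-irrefl (≡.sym total≡))
  identity-unique {I} (remove t t∈I K≐ e) I≐J total≡ = ⊥-elim
    (proj₂ (proj₁ K≐ (gain≡0⇒⊇ e (ℕₚ.+-cancelˡ-≡ (ℓ₀ I) _ 0
      (≡.trans total≡ (≡.sym (ℕₚ.+-identityʳ _)))) (proj₁ I≐J t∈I))) refl)

  ℓ-w₀-gen : ∀ {I s} → s ∉ set I → ℓ (w₀ I ∙ gen s) ≡ suc (ℓ₀ I)
  ℓ-w₀-gen {I} {s} s∉I = ≡.trans (≡.sym (ℓ-⁻¹ _))
    (≡.trans (ℓ-cong (solve (⟪w₀⟫ I ∷ ⟪ s ⟫ ∷ []) (λ w s → ⊖ (w ⊕ s) , s ⊕ w) refl)) longer)
    where
    longer : ℓ (gen s ∙ w₀ I) ≡ suc (ℓ₀ I)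
    longer = ℓ-longer s (w₀ I) (≯⇒longer s (w₀ I) λ shorter → s∉I (descent∈ s (w₀∈ I) shorter))

  descent-unique : ∀ {M L} (e : Expression M L) → gain (descend e) ≡ 0 → set M ⊆ set L →
                   Pointwise (λ A B → set A ≐ set B) (terms e) (L ∷ [])
  descent-unique     (stop M≐L)         _    _   = M≐L ∷ []
  descent-unique {M} (add _ s∉M K≐ e)   g≡0 _   = ⊥-elim (add-gain≢0 M s∉M K≐ e g≡0)
  descent-unique     (remove t t∈M K≐ e) g≡0 M⊆L =
    ⊥-elim (proj₂ (proj₁ K≐ (gain≡0⇒⊇ e g≡0 (M⊆L t∈M))) refl)

  peak-unique : ∀ {K L K′} t → t ∈ set K → set L ≐ set (K ─ t) → set K ⊆ set K′ →
                (e : Expression K′ L) → set (proj₁ (ascend e)) ⊆ set K → ℓ₀ K ≡ total (ascend e) →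
                Pointwise (λ A B → set A ≐ set B) (terms e) (K ∷ L ∷ [])
  peak-unique t t∈K L≐ K⊆K′ (stop K′≐L) _ _ = ⊥-elim (proj₂ (proj₁ L≐ (proj₁ K′≐L (K⊆K′ t∈K))) refl)
  peak-unique t t∈K L≐ K⊆K′ (add s s∉K′ K″≐ e) ⊆K _ =
    ⊥-elim (s∉K′ (K⊆K′ (⊆K (ascend-⊇ e (proj₂ K″≐ (inj₂ refl))))))
  peak-unique {K} {L} {K′} t t∈K L≐ K⊆K′ (remove {K = K″} t′ t′∈K′ K″≐ e) ⊆K len =
    (⊆K , K⊆K′) ∷ descent-unique e gain≡0 K″⊆L
    where
    gain≡0 : gain (descend e) ≡ 0
    gain≡0 = ℕₚ.+-cancelˡ-≡ (ℓ₀ K′) _ _ (≡.trans (≡.sym len)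
      (≡.trans (ℕₚ.≤-antisym (ℓ₀-mono {K} {K′} K⊆K′) (ℓ₀-mono {K′} {K} ⊆K))
        (≡.sym (ℕₚ.+-identityʳ _))))
    -- Otherwise t′ would belong to L, but with no gain left a removed element never comes back.
    t≡t′ : t ≡ t′
    t≡t′ = decidable-stable em λ t≢t′ →
      proj₂ (proj₁ K″≐ (gain≡0⇒⊇ e gain≡0 (proj₂ L≐ (⊆K t′∈K′ , t≢t′)))) refl
    K″⊆L : set K″ ⊆ set L
    K″⊆L k∈ = let k∈K′ , k≢t′ = proj₁ K″≐ k∈ in
      proj₂ L≐ (⊆K k∈K′ , λ t≡k → k≢t′ (≡.trans (≡.sym t≡t′) t≡k))

  -- Once b ∈ I is removed, the remaining factor w_I′ w_I w_K of w_K is lengthened by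
  -- the element l of L with w_K l w_K = w_I b w_I, so no reduced expression can end in L.
  no-removal : ∀ {I K L b I′} → set I ⊆ set K → ℓ₀ I < ℓ₀ K → set L ≐[ w₀ K ] set I →
               b ∈ set I → set I′ ⊆ set I → b ∉ set I′ → (e : Expression I′ L) →
               w₀ K ≈ w₀ I ∙ tailValue (descend e) → ¬ (ℓ₀ K ≡ ℓ₀ I + gain (descend e))
  no-removal I⊆K I<K L≐I b∈I I′⊆I b∉I′ (stop _) _ len =
    ℕₚ.<-irrefl (≡.sym (≡.trans len (ℕₚ.+-identityʳ _))) I<K
  no-removal {I} {K} I⊆K I<K L≐I b∈I I′⊆I b∉I′ (remove _ _ K≐ e) =
    no-removal {I} {K} I⊆K I<K L≐I b∈I
      (λ k∈ → I′⊆I (proj₁ (proj₁ K≐ k∈))) (λ b∈ → b∉I′ (proj₁ (proj₁ K≐ b∈))) e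
  no-removal {I} {K} {L} {b} {I′} I⊆K I<K L≐I b∈I I′⊆I b∉I′ (add s s∉I′ K≐ e) w₀≈ len =
    let i , i∈I , wbw≈i = w₀-conj-gen I b∈I
        l , l∈L , wiw≈l = proj₂ L≐I (gen i , (i , i∈I , ≈-refl) , ≈-refl)
    in lengthened l l∈L (≈-trans (∙-congʳ (∙-congˡ wbw≈i)) wiw≈l)
    where
    open ℕₚ.≤-Reasoning
    grows = add-growing I′ s∉I′ K≐ e
    K′ = proj₁ (ascend e)
    x  = tailValue (proj₂ (ascend e))
    g  = gain (proj₂ (ascend e))
    d  = ℓ₀ K′ ∸ ℓ₀ I′
    v  = w₀ I′ ∙ gen b ∙ w₀ I
    u∈ : w₀ I′ ∙ gen b ∈ ⟨ set I ⟩
    u∈ = ⟨⟩-∙ (⟨⟩-mono I′⊆I (w₀∈ I′)) (⟨⟩-gen b∈I)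
    -- Complements are taken in W_K and then in W_I. Because b ∉ I′, the element w_I′ b is longer
    -- than w_I′ by one, and this unit contradicts `ascend-descentʳ`.
    ℓvw : ℓ (v ∙ w₀ K) ≡ suc (ℓ₀ I′) + (d + g)
    ℓvw = ℕₚ.+-cancelˡ-≡ (ℓ v) _ _ (E.begin
      ℓ v + ℓ (v ∙ w₀ K)                        E.≡⟨ ℓ-w₀ K (⟨⟩-mono I⊆K (⟨⟩-∙ u∈ (w₀∈ I))) ⟨
      ℓ₀ K                                      E.≡⟨ len ⟩
      ℓ₀ I + (d + g)                            E.≡⟨ cong (_+ (d + g)) (ℓ-w₀ I u∈) ⟩
      ℓ (w₀ I′ ∙ gen b) + ℓ v + (d + g)         E.≡⟨ cong (λ n → n + ℓ v + (d + g)) (ℓ-w₀-gen {I′} b∉I′) ⟩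
      suc (ℓ₀ I′) + ℓ v + (d + g)               E.≡⟨ cong (_+ (d + g)) (ℕₚ.+-comm (suc (ℓ₀ I′)) (ℓ v)) ⟩
      ℓ v + suc (ℓ₀ I′) + (d + g)               E.≡⟨ ℕₚ.+-assoc (ℓ v) _ _ ⟩
      ℓ v + (suc (ℓ₀ I′) + (d + g))             E.∎)
      where module E = ≡.≡-Reasoning
    c≈ : w₀ K′ ∙ x ≈ w₀ I′ ∙ (w₀ I ∙ w₀ K)
    c≈ = ≈-trans (solve (⟪w₀⟫ I ∷ ⟪w₀⟫ I′ ∷ free (w₀ K′) ∷ free x ∷ [])
             (λ i i′ k x → k ⊕ x , i′ ⊕ (i ⊕ (i ⊕ ((⊖ i′ ⊕ k) ⊕ x)))) refl)
           (∙-congˡ (∙-congˡ (≈-sym w₀≈)))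
    lengthened : ∀ l → l ∈ set L → w₀ K ∙ (w₀ I ∙ gen b ∙ w₀ I) ∙ w₀ K ⁻¹ ≈ gen l → ⊥
    lengthened l l∈L wbw≈l = ℕₚ.<-irrefl refl (begin-strict
      ℓ (v ∙ w₀ K)                <⟨ subst (_< ℓ₀ K′ + g) (ℓ-cong cl≈) (ascend-descentʳ e l∈L) ⟩
      ℓ₀ K′ + g                   ≡⟨ cong (_+ g) (ℕₚ.m+[n∸m]≡n (ℕₚ.<⇒≤ (growing⇒< {I′} {K′} grows))) ⟨
      ℓ₀ I′ + d + g               ≡⟨ ℕₚ.+-assoc (ℓ₀ I′) d g ⟩
      ℓ₀ I′ + (d + g)             <⟨ ℕₚ.≤-refl ⟩
      suc (ℓ₀ I′) + (d + g)       ≡⟨ ℓvw ⟨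
      ℓ (v ∙ w₀ K)                ∎)
      where
      cl≈ : w₀ K′ ∙ x ∙ gen l ≈ v ∙ w₀ K
      cl≈ = ≈-trans (∙-cong c≈ (≈-sym wbw≈l))
        (solve (⟪w₀⟫ I ∷ ⟪w₀⟫ I′ ∷ ⟪w₀⟫ K ∷ ⟪ b ⟫ ∷ [])
          (λ i i′ k b → (i′ ⊕ (i ⊕ k)) ⊕ ((k ⊕ ((i ⊕ b) ⊕ i)) ⊕ ⊖ k) , ((i′ ⊕ b) ⊕ i) ⊕ k) refl)

  -- An element of the first peak shortens the first factor, while the other factors contribute at
  -- most their gain; so it is a left descent of w_K.
  first-peak-⊆ : ∀ {I J K} (e : Expression I J) → w₀ K ≈ value (group e) →
                 ℓ₀ K ≡ total (group e) → set (proj₁ (group e)) ⊆ set K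
  first-peak-⊆ {K = K} e w₀≈ len {k} k∈ = descent∈ k (w₀∈ K) (begin-strict
    ℓ (gen k ∙ w₀ K)               ≡⟨ ℓ-cong (≈-trans (∙-congˡ w₀≈) (≈-sym (assoc _ _ _))) ⟩
    ℓ (gen k ∙ w₀ K₁ ∙ x)          ≤⟨ ℓ-∙ _ _ ⟩
    ℓ (gen k ∙ w₀ K₁) + ℓ x        ≤⟨ ℕₚ.+-monoʳ-≤ _ (ℓ-tailValue (ascend-growing e)) ⟩
    ℓ (gen k ∙ w₀ K₁) + gain rest  <⟨ ℕₚ.+-monoˡ-< (gain rest) (w₀-descents K₁ k k∈) ⟩
    ℓ₀ K₁ + gain rest              ≡⟨ len ⟨
    ℓ₀ K                           ∎)
    where
    open ℕₚ.≤-Reasoning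
    K₁   = proj₁ (group e)
    rest = proj₂ (group e)
    x    = tailValue rest

  -- The star product with a longest element

  -- Removing the prefix w_K from the product leaves another element of W_K z, hence one at least as
  -- long as z. So the product has length at least ℓ(K) + ℓ(z), which only w_K z attains in W_K z.
  *-absorbs : ∀ (K : Finitary) {x y z u} → x ≈ w₀ K → NoDescents (set K) z →
              u ∈ ⟨ set K ⟩ → y ≈ u ∙ z → x * y ≈ w₀ K ∙ z
  *-absorbs K {x} {y} {z} {u} x≈ none u∈ y≈ =
    go (⋆-prefix y word reduced) (⋆-orbit y word
      (reduced-letters word reduced (⟨⟩-resp (≈-sym word≈) (w₀∈ K))))
    where
    word = reducedWord x
    reduced : Reduced word
    reduced = reducedWord-reduced x
    word≈ : eval word ≈ w₀ K
    word≈ = ≈-trans (eval-reducedWord x) x≈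
    go : ∀ {c} → eval word ≼ c → ∃[ v ] v ∈ ⟨ set K ⟩ × c ≈ v ∙ y → c ≈ w₀ K ∙ z
    go {c} (d , c≈ , ℓc) (v , v∈ , c≈′) =
      ≈-trans c≈vz (∙-congʳ (w₀-unique K vu∈ (ℕₚ.+-cancelʳ-≤ (ℓ z) _ _ (begin
        ℓ₀ K + ℓ z                            ≤⟨ ℕₚ.+-monoʳ-≤ (ℓ₀ K) (ℕₚ.m≤n+m (ℓ z) _) ⟩
        ℓ₀ K + (ℓ (w₀ K ∙ (v ∙ u)) + ℓ z)     ≡⟨ cong (λ n → ℓ₀ K + n) (noDescents⇒ℓ none (⟨⟩-∙ (w₀∈ K) vu∈)) ⟨
        ℓ₀ K + ℓ (w₀ K ∙ (v ∙ u) ∙ z)         ≡⟨ cong₂ _+_ (ℓ-cong word≈) (ℓ-cong d≈) ⟨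
        ℓ (eval word) + ℓ d                   ≡⟨ ℓc ⟨
        ℓ c                                   ≡⟨ ℓ-cong c≈vz ⟩
        ℓ (v ∙ u ∙ z)                         ≡⟨ noDescents⇒ℓ none vu∈ ⟩
        ℓ (v ∙ u) + ℓ z                       ∎))))
      where
      open ℕₚ.≤-Reasoning
      vu∈ : v ∙ u ∈ ⟨ set K ⟩
      vu∈ = ⟨⟩-∙ v∈ u∈
      c≈vz : c ≈ v ∙ u ∙ z
      c≈vz = ≈-trans c≈′ (≈-trans (∙-congˡ y≈) (≈-sym (assoc _ _ _)))
      d≈ : d ≈ w₀ K ∙ (v ∙ u) ∙ z
      d≈ = ≈-trans (solve (⟪w₀⟫ K ∷ free d ∷ []) (λ w d → d , w ⊕ (w ⊕ d)) refl)
        (≈-trans (∙-congˡ (≈-trans (≈-trans (∙-congʳ (≈-sym word≈)) (≈-sym c≈)) c≈vz))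
          (≈-sym (assoc _ _ _)))

  ≈ε⊎descent : ∀ x → x ≈ ε ⊎ (∃[ s ] ℓ (gen s ∙ x) < ℓ x)
  ≈ε⊎descent x = go (reducedWord x) (reducedWord-reduced x) (eval-reducedWord x)
    where
    go : ∀ u → Reduced u → eval u ≈ x → x ≈ ε ⊎ (∃[ s ] ℓ (gen s ∙ x) < ℓ x)
    go []      _   ev = inj₁ (≈-sym ev)
    go (s ∷ u) red ev = inj₂ (s , subst₂ _<_
      (ℓ-cong (≈-trans (≈-sym (gen-gen s (eval u))) (∙-congˡ ev))) (ℓ-cong ev)
      (proj₂ (reduced-tail s u red)))

  -- The core coset of I + s - t

  module Elementary (I : Finitary) (s : S) (s∉I : s ∉ set I) (fin : IsFinitary (set I ∪ ｛ s ｝))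
                    (t : S) (t≈ : gen t ≈ w₀ (set I ∪ ｛ s ｝ , fin) ∙ gen s ∙ w₀ (set I ∪ ｛ s ｝ , fin))
                    (t∈K : t ∈ set I ∪ ｛ s ｝) where

    K L : Finitary
    K = (set I ∪ ｛ s ｝) , fin
    L = K ─ t

    [I+s-t] : Expression I L
    [I+s-t] = add {K = K} s s∉I ≐-refl (remove {K = L} t t∈K ≐-refl (stop {J = L} ≐-refl))

    p : Coset I L
    p = W[ w₀ K ]W

    -- Conjugation by w_K permutes K and swaps s with t, so it swaps their complements I and L in K.
    L≐I : set L ≐[ w₀ K ] set I
    L≐I = to , from
      where
      conj² : ∀ k {x} → w₀ K ∙ gen k ∙ w₀ K ≈ x → gen k ≈ w₀ K ∙ x ∙ w₀ K
      conj² k eq = ≈-trans (solve (⟪w₀⟫ K ∷ ⟪ k ⟫ ∷ []) (λ w k → k , (w ⊕ ((w ⊕ k) ⊕ w)) ⊕ w) refl)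
        (∙-congʳ (∙-congˡ eq))
      Partner : S → Set a
      Partner k = ∃[ j ] j ∈ set K × w₀ K ∙ gen k ∙ w₀ K ≈ gen j
      to-gen : ∀ {l} → ¬ (t ≡ l) → Partner l → gen l ∈ conjugate (w₀ K) (gens (set I))
      to-gen {l} l≢t (k , inj₁ k∈I , eq) = gen k , (k , k∈I , ≈-refl) ,
        ≈-trans (conj² l eq) (∙-congˡ (≈-sym (w₀⁻¹ K)))
      to-gen {l} l≢t (_ , inj₂ refl , eq) =
        ⊥-elim (l≢t (gen-injective (≈-trans t≈ (≈-sym (conj² l eq)))))
      to : gens (set L) ⊆ conjugate (w₀ K) (gens (set I))
      to (l , (l∈K , l≢t) , w≈) =
        let y , y∈ , eq = to-gen l≢t (w₀-conj-gen K l∈K) in y , y∈ , ≈-trans w≈ eq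
      from-gen : ∀ {i} → i ∈ set I → Partner i → w₀ K ∙ gen i ∙ w₀ K ∈ gens (set L)
      from-gen {i} i∈I (k , k∈K , eq) = k , (k∈K , k≢t) , eq
        where
        k≢t : ¬ (t ≡ k)
        k≢t refl = s∉I (subst (_∈ set I) (gen-injective
          (≈-trans (conj² i (≈-trans eq t≈)) (≈-sym (conj² s ≈-refl)))) i∈I)
      from : conjugate (w₀ K) (gens (set I)) ⊆ gens (set L)
      from (y , (i , i∈I , y≈) , w≈) =
        let l , l∈L , eq = from-gen i∈I (w₀-conj-gen K {i} (inj₁ i∈I))
        in l , l∈L , ≈-trans w≈ (≈-trans (∙-cong (∙-congˡ y≈) (w₀⁻¹ K)) eq)

    L⊆K : set L ⊆ set K
    L⊆K = proj₁

    I<K : ℓ₀ I < ℓ₀ K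
    I<K = ℓ₀-strict {I} {K} inj₁ (inj₂ refl) s∉I

    z : Carrier
    z = w₀ K ∙ w₀ L

    z∈p : z ∈ ⟦ p ⟧
    z∈p = ε , w₀ L , ⟨⟩-ε , w₀∈ L , ∙-congʳ (≈-sym (identityˡ _))

    I≐L : set I ≐[ z ] set L
    I≐L = ≐[]-trans (≐[]-cong (w₀⁻¹ K) (≐[]-sym L≐I)) (w₀-≐[] L)

    -- Moved past w_K, i becomes an element l of L, which shortens w_L; taking complements in W_K
    -- reverses the comparison.
    z-noDescents : NoDescents (set I) z
    z-noDescents i i∈I = go (proj₂ L≐I (gen i , (i , i∈I , ≈-refl) , ≈-refl))
      where
      open ℕₚ.≤-Reasoning
      w₀L∈ : w₀ L ∈ ⟨ set K ⟩
      w₀L∈ = ⟨⟩-mono L⊆K (w₀∈ L)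
      go : w₀ K ∙ gen i ∙ w₀ K ⁻¹ ∈ gens (set L) → ℓ z < ℓ (gen i ∙ z)
      go (l , l∈L , eq) = ℕₚ.+-cancelˡ-< (ℓ₀ L) (ℓ z) (ℓ (gen i ∙ z)) (begin-strict
        ℓ₀ L + ℓ z                                      ≡⟨ ℓ-w₀ʳ K w₀L∈ ⟨
        ℓ₀ K                                            ≡⟨ ℓ-w₀ʳ K (⟨⟩-∙ (⟨⟩-gen (L⊆K l∈L)) w₀L∈) ⟩
        ℓ (gen l ∙ w₀ L) + ℓ (w₀ K ∙ (gen l ∙ w₀ L))    <⟨ ℕₚ.+-monoˡ-< _ (w₀-descents L l l∈L) ⟩
        ℓ₀ L + ℓ (w₀ K ∙ (gen l ∙ w₀ L))                ≡⟨ cong (λ n → ℓ₀ L + n) (ℓ-cong kl≈) ⟩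
        ℓ₀ L + ℓ (gen i ∙ z)                            ∎)
        where
        kl≈ : w₀ K ∙ (gen l ∙ w₀ L) ≈ gen i ∙ z
        kl≈ = ≈-trans (∙-congˡ (∙-congʳ (≈-sym eq))) (solve (⟪w₀⟫ K ∷ ⟪w₀⟫ L ∷ ⟪ i ⟫ ∷ [])
          (λ k l i → k ⊕ (((k ⊕ i) ⊕ ⊖ k) ⊕ l) , i ⊕ (k ⊕ l)) refl)

    private module P = CoreCoset p z∈p I≐L

    p-core : Core p
    p-core = ≐[]-cong (≈-sym (P.min≈ z-noDescents)) I≐L

    ⟦p⟧⊆⟨K⟩ : ⟦ p ⟧ ⊆ ⟨ set K ⟩
    ⟦p⟧⊆⟨K⟩ (x , y , x∈ , y∈ , eq) =
      ⟨⟩-resp (≈-sym eq) (⟨⟩-∙ (⟨⟩-∙ (⟨⟩-mono inj₁ x∈) (w₀∈ K)) (⟨⟩-mono L⊆K y∈))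

    max-p≈ : max p ≈ w₀ K
    max-p≈ = w₀-unique K (⟦p⟧⊆⟨K⟩ (max∈ p)) (P.max-longest z-noDescents (rep∈ p))

    unique : (e : Expression I L) → w₀ K ≈ value (group e) → ℓ₀ K ≡ total (group e) → e ≋ [I+s-t]
    unique (stop _) _ len = contradiction I<K
      (ℕₚ.<-irrefl (≡.sym (≡.trans len (ℕₚ.+-identityʳ _))))
    unique (remove b b∈I K≐ e) w₀≈ len = ⊥-elim (no-removal {I} {K} inj₁ I<K L≐I b∈I
      (λ k∈ → proj₁ (proj₁ K≐ k∈)) (λ b∈ → proj₂ (proj₁ K≐ b∈) refl) e w₀≈ len)
    unique (add {K = K′} s′ s′∉I K′≐ e) w₀≈ len =
      ≐-refl ∷ peak-unique {K = K} {L} t t∈K ≐-refl K⊆K′ e peak⊆K len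
      where
      peak⊆K : set (proj₁ (ascend e)) ⊆ set K
      peak⊆K = first-peak-⊆ {I} {K = K} (add {K = K′} s′ s′∉I K′≐ e) w₀≈ len
      -- The first element added survives into the first peak, which lies in K; outside I this
      -- leaves only s.
      s≡s′ : s′ ∈ set K → s ≡ s′
      s≡s′ (inj₁ s′∈I) = ⊥-elim (s′∉I s′∈I)
      s≡s′ (inj₂ s≡s′) = s≡s′
      s∈K′ : s ∈ set K′
      s∈K′ = proj₂ K′≐ (inj₂ (≡.sym (s≡s′ (peak⊆K (ascend-⊇ e (proj₂ K′≐ (inj₂ refl)))))))
      K⊆K′ : set K ⊆ set K′
      K⊆K′ (inj₁ i∈I)  = proj₂ K′≐ (inj₁ i∈I)
      K⊆K′ (inj₂ refl) = s∈K′

    [I+s-t]-unique : UniqueReducedExpression p [I+s-t]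
    [I+s-t]-unique =
      (≈-trans max-p≈ (≈-sym (identityʳ _)) ,
       cong +_ (≡.trans (ℓ-cong max-p≈) (≡.sym (ℕₚ.+-identityʳ _)))) ,
      λ e red → unique e (≈-trans (≈-sym max-p≈) (proj₁ red))
        (≡.trans (ℓ-cong (≈-sym max-p≈)) (reduced⇒total {p = p} e red))

    -- Minimality of y is asked for in W_K y and not just in W_L y: it makes the lengths add in w_K
    -- y, so that the composition is reduced.
    module Composite {J : Finitary} {y : Carrier} (none : NoDescents (set K) y)
                     (L≐J : set L ≐[ y ] set J) where

      q : Coset L J
      q = W[ y ]W

      private
        module Q = CoreCoset q (rep∈ q) L≐J

        y-noDescents : NoDescents (set L) y
        y-noDescents l l∈L = none l (L⊆K l∈L)

      q-core : Core q
      q-core = ≐[]-cong (≈-sym (Q.min≈ y-noDescents)) L≐J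

      max-q≈ : max q ≈ w₀ L ∙ y
      max-q≈ = Q.max≈ y-noDescents

      p*q≈ : max p * max q ≈ w₀ K ∙ y
      p*q≈ = *-absorbs K max-p≈ none (⟨⟩-mono L⊆K (w₀∈ L)) max-q≈

      p*q-reduced : ReducedComposition p q
      p*q-reduced =
        ≈-trans p*q≈ (≈-trans
          (solve (free (w₀ K) ∷ free (w₀ L) ∷ free y ∷ [])
            (λ k l y → k ⊕ y , (k ⊕ ⊖ l) ⊕ (l ⊕ y)) refl)
          (≈-sym (∙-cong (∙-congʳ max-p≈) max-q≈))) ,
        (begin
          + ℓ (max p * max q)                              ≡⟨ cong +_ (ℓ-cong p*q≈) ⟩
          + ℓ (w₀ K ∙ y)                                   ≡⟨ cong +_ (noDescents⇒ℓ none (w₀∈ K)) ⟩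
          + ℓ₀ K ℤ.+ + ℓ y                                 ≡⟨ ℤSolver.+-*-Solver.solve 3
                                                                (λ k l y → k :+ y := k :- l :+ (l :+ y)) refl
                                                                (+ ℓ₀ K) (+ ℓ₀ L) (+ ℓ y) ⟩
          + ℓ₀ K ℤ.- + ℓ₀ L ℤ.+ + (ℓ₀ L + ℓ y)             ≡⟨ cong₂ (λ i j → + i ℤ.- + ℓ₀ L ℤ.+ + j)
                                                                (ℓ-cong max-p≈) ℓ-max-q ⟨
          + ℓ (max p) ℤ.- + ℓ₀ L ℤ.+ + ℓ (max q)           ∎)
        where
        open ≡.≡-Reasoning
        open ℤSolver.+-*-Solver using (_:+_; _:-_; _:=_)
        ℓ-max-q : ℓ (max q) ≡ ℓ₀ L + ℓ y
        ℓ-max-q = ≡.trans (ℓ-cong max-q≈) (noDescents⇒ℓ y-noDescents (w₀∈ L))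

  -- Decomposition of a core coset

  ⟦⟧-resp : ∀ {I J} (p : Coset I J) {v w} → v ≈ w → v ∈ ⟦ p ⟧ → w ∈ ⟦ p ⟧
  ⟦⟧-resp p v≈w (x , y , x∈ , y∈ , v≈) = x , y , x∈ , y∈ , ≈-trans (≈-sym v≈w) v≈

  ≐[ε]⇒⊆ : ∀ {I J} → I ≐[ ε ] J → I ⊆ J
  ≐[ε]⇒⊆ {I} {J} I≐J {i} i∈ = go (proj₁ I≐J (i , i∈ , ≈-refl))
    where
    go : gen i ∈ conjugate ε (gens J) → i ∈ J
    go (y , (j , j∈ , y≈j) , i≈) = subst (_∈ J) (≡.sym (gen-injective
      (≈-trans i≈ (≈-trans (solve (free y ∷ []) (λ y → (id ⊕ y) ⊕ ⊖ id , y) refl) y≈j)))) j∈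

  module CoreDecomposition (I J : Finitary) (r : Coset I J) (r-core : Core r) where

    private
      x = min r

    open CoreCoset r (min∈ r) r-core using (max≈)

    identity-case : x ≈ ε → Σ[ I≐J ∈ set I ≐ set J ] (x ≈ ε × UniqueReducedExpression r (stop I≐J))
    identity-case x≈ε = I≐J , x≈ε ,
      (≈-trans max≈w₀ (≈-sym (identityʳ _)) , cong +_ (≡.trans (ℓ-cong max≈w₀) (≡.sym (ℕₚ.+-identityʳ _)))) ,
      λ e red → identity-unique e I≐J (≡.trans (≡.sym (reduced⇒total {p = r} e red)) (ℓ-cong max≈w₀))
      where
      I≐ᵋJ : set I ≐[ ε ] set J
      I≐ᵋJ = ≐[]-cong x≈ε r-core
      I≐J : set I ≐ set J
      I≐J = ≐[ε]⇒⊆ I≐ᵋJ , ≐[ε]⇒⊆ (≐[]-cong ε⁻¹≈ε (≐[]-sym I≐ᵋJ))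
      max≈w₀ : max r ≈ w₀ I
      max≈w₀ = ≈-trans (max≈ (min-noDescents r)) (≈-trans (∙-congˡ x≈ε) (identityʳ _))

    module Nontrivial (s : S) (shorter : ℓ (gen s ∙ x) < ℓ x) where

      y : Carrier
      y = w₀ I ∙ x

      y∈r : y ∈ ⟦ r ⟧
      y∈r = ⟦⟧-∙ˡ r (w₀∈ I) (min∈ r)

      ℓ-y : ℓ y ≡ ℓ₀ I + ℓ x
      ℓ-y = noDescents⇒ℓ (min-noDescents r) (w₀∈ I)

      s∉I : s ∉ set I
      s∉I s∈I = ℕₚ.<-asym shorter (min-noDescents r s s∈I)

      private
        I⁺ = set I ∪ ｛ s ｝

      -- y = x g for some g ∈ W_J of length ℓ(I), so the descents of x are descents of y.
      s-descent : ℓ (gen s ∙ y) < ℓ y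
      s-descent = go (reducedIn (w₀∈ I))
        where
        open ℕₚ.≤-Reasoning
        go : ∃[ u ] All (_∈ set I) u × eval u ≈ w₀ I × Reduced u → ℓ (gen s ∙ y) < ℓ y
        go (u , u∈ , ev , red) = bound (slide r-core u u∈)
          where
          bound : ∃[ v ] All (_∈ set J) v × length v ≡ length u × eval u ∙ x ≈ x ∙ eval v →
                  ℓ (gen s ∙ y) < ℓ y
          bound (v , _ , len , eq) = begin-strict
            ℓ (gen s ∙ y)                  ≡⟨ ℓ-cong (≈-trans (∙-congˡ (≈-trans (∙-congʳ (≈-sym ev)) eq))
                                                (≈-sym (assoc _ _ _))) ⟩
            ℓ (gen s ∙ x ∙ eval v)         ≤⟨ ℓ-∙ _ _ ⟩
            ℓ (gen s ∙ x) + ℓ (eval v)     <⟨ ℕₚ.+-mono-<-≤ shorter (ℓ-minimal v ≈-refl) ⟩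
            ℓ x + length v                 ≡⟨ cong (λ n → ℓ x + n) len ⟩
            ℓ x + length u                 ≤⟨ ℕₚ.+-monoʳ-≤ (ℓ x) red ⟩
            ℓ x + ℓ (eval u)               ≡⟨ cong (λ n → ℓ x + n) (ℓ-cong ev) ⟩
            ℓ x + ℓ₀ I                     ≡⟨ ℕₚ.+-comm (ℓ x) (ℓ₀ I) ⟩
            ℓ₀ I + ℓ x                     ≡⟨ ℓ-y ⟨
            ℓ y                            ∎

      y-descents : AllDescents I⁺ y
      y-descents i (inj₁ i∈I)  = begin-strict
        ℓ (gen i ∙ y)                  ≡⟨ ℓ-cong (assoc _ _ _) ⟨
        ℓ (gen i ∙ w₀ I ∙ x)           ≤⟨ ℓ-∙ _ _ ⟩
        ℓ (gen i ∙ w₀ I) + ℓ x         <⟨ ℕₚ.+-monoˡ-< (ℓ x) (w₀-descents I i i∈I) ⟩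
        ℓ₀ I + ℓ x                     ≡⟨ ℓ-y ⟨
        ℓ y                            ∎
        where open ℕₚ.≤-Reasoning
      y-descents i (inj₂ refl) = s-descent

      fin : IsFinitary I⁺
      fin = descents⇒finitary (finite I) y-descents

      private
        K : Finitary
        K = I⁺ , fin

      z : Carrier
      z = w₀ K ∙ y

      -- Any v in W_K takes exactly ℓ(v) off y. As k w_K is shorter than w_K, it takes off less.
      z-noDescents : NoDescents I⁺ z
      z-noDescents k k∈K = ℕₚ.+-cancelˡ-< (ℓ₀ K) (ℓ z) (ℓ (gen k ∙ z)) (begin-strict
        ℓ₀ K + ℓ z                                  ≡⟨ allDescents⇒ℓ y-descents (w₀∈ K) ⟨
        ℓ y                                         ≡⟨ allDescents⇒ℓ y-descents (⟨⟩-∙ (⟨⟩-gen k∈K) (w₀∈ K)) ⟩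
        ℓ (gen k ∙ w₀ K) + ℓ (gen k ∙ w₀ K ∙ y)     <⟨ ℕₚ.+-monoˡ-< _ (w₀-descents K k k∈K) ⟩
        ℓ₀ K + ℓ (gen k ∙ w₀ K ∙ y)                 ≡⟨ cong (λ n → ℓ₀ K + n) (ℓ-cong (assoc _ _ _)) ⟩
        ℓ₀ K + ℓ (gen k ∙ z)                        ∎)
        where open ℕₚ.≤-Reasoning

      module _ (t : S) (t∈K : t ∈ I⁺) (t≈ : gen t ≈ w₀ K ∙ gen s ∙ w₀ K) where

        open Elementary I s s∉I fin t t≈ t∈K using (L; p; L≐I; module Composite)

        -- The three conjugators compose to w_K (w_I x), which unfolds from z.
        L≐J : set L ≐[ z ] set J
        L≐J = ≐[]-trans L≐I (≐[]-trans (w₀-≐[] I) r-core)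

        open Composite {J} z-noDescents L≐J using (q; p*q≈)

        -- The representative `max p * max q` is w_K z = y, an element of r, and any element
        -- determines its double coset.
        r≈p*q : r ≈ᶜ p *ᶜ q
        r≈p*q = ∈⟦⟧⇒≈ᶜ r (⟦⟧-resp r y≈ y∈r)
          where
          y≈ : y ≈ max p * max q
          y≈ = ≈-trans (solve (⟪w₀⟫ K ∷ free y ∷ []) (λ k y → y , k ⊕ (k ⊕ y)) refl) (≈-sym p*q≈)

    FactorsThroughElementary : Set (lsuc a)
    FactorsThroughElementary =
      ∃[ s ] Σ[ s∉I ∈ s ∉ set I ] Σ[ fin ∈ IsFinitary (set I ∪ ｛ s ｝) ]
      let K : Finitary
          K = (set I ∪ ｛ s ｝) , fin
      in
      ∃[ t ] gen t ≈ w₀ K ∙ gen s ∙ w₀ K ×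
      Σ[ t∈K ∈ t ∈ set K ]
      let L : Finitary
          L = K ─ t
          [I+s-t] : Expression I L
          [I+s-t] = add {K = K} s s∉I ≐-refl (remove {K = L} t t∈K ≐-refl (stop {J = L} ≐-refl))
      in
      Σ[ p ∈ Coset I L ] Σ[ q ∈ Coset L J ]
        ( Core p × Core q
        × UniqueReducedExpression p [I+s-t]
        × ReducedComposition p q
        × r ≈ᶜ p *ᶜ q )

    nontrivial-case : ∃[ s ] ℓ (gen s ∙ x) < ℓ x → FactorsThroughElementary
    nontrivial-case (s , shorter) = go (w₀-conj-gen K {s} (inj₂ refl))
      where
      open Nontrivial s shorter
      K : Finitary
      K = (set I ∪ ｛ s ｝) , fin
      go : ∃[ t ] t ∈ set K × w₀ K ∙ gen s ∙ w₀ K ≈ gen t → FactorsThroughElementary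
      go (t , t∈K , eq) =
        s , s∉I , fin , t , ≈-sym eq , t∈K , E.p , Q.q ,
        E.p-core , Q.q-core , E.[I+s-t]-unique , Q.p*q-reduced , r≈p*q t t∈K (≈-sym eq)
        where
        module E = Elementary I s s∉I fin t (≈-sym eq) t∈K
        module Q = E.Composite {J} z-noDescents (L≐J t t∈K (≈-sym eq))

theorem2p16 :
  {a : Level} (em : ExcludedMiddle a) (𝒲 : CoxeterSystem a) →
  let open Cosets em 𝒲 in
  (I J : Finitary) (r : Coset I J) → Core r →
  ( Σ[ I≐J ∈ set I ≐ set J ]
      ( min r ≈ ε
      × UniqueReducedExpression r (stop I≐J) ) )
  ⊎
  ( ∃[ s ] Σ[ s∉I ∈ s ∉ set I ] Σ[ fin ∈ IsFinitary (set I ∪ ｛ s ｝) ]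
    let K : Finitary
        K = (set I ∪ ｛ s ｝) , fin
    in
    ∃[ t ] gen t ≈ w₀ K ∙ gen s ∙ w₀ K ×
    Σ[ t∈K ∈ t ∈ set K ]
    let L : Finitary
        L = K ─ t
        [I+s-t] : Expression I L
        [I+s-t] = add {K = K} s s∉I ≐-refl (remove {K = L} t t∈K ≐-refl (stop {J = L} ≐-refl))
    in
    Σ[ p ∈ Coset I L ] Σ[ q ∈ Coset L J ]
      ( Core p × Core q
      × UniqueReducedExpression p [I+s-t]
      × ReducedComposition p q
      × r ≈ᶜ p *ᶜ q ) )
theorem2p16 em 𝒲 I J r core = Sum.map identity-case nontrivial-case (≈ε⊎descent (min r))
  where
  open CoxeterCosets em 𝒲
  open Cosets em 𝒲 using (min)
  open CoreDecomposition I J r core
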